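{- Let $(G,\lambda)$ be an MAT-labeled graph with vertex set $N_G=[\ell]$. Let $\mathcal{P}$ be the poset whose elements are the sets $\{i\}$ for $1\le i\le\ell$ together with all principal cliques of $(G,\lambda)$, ordered by inclusion, with rank function $\operatorname{rk}_{\mathcal{P}}(v)=|v|$. Then $\mathcal{P}$ is an LR-vine. In particular, if $G$ is a complete graph, then $\mathcal{P}$ is an R-vine.
   Context: Graphs are finite, simple and undirected. An edge-labeled graph $(G,\lambda)$ is a graph $G$ with a map $\lambda\colon E_G\to\mathbb{Z}_{>0}$; $\pi_k=\lambda^{ -1}(k)$, and $\pi_{<k},\pi_{\le k}$ are the sets of edges of label $<k$, $\le k$. For an edge $\{u,v\}\in\pi_k$, a conditioning vertex is a vertex $h$ with $\{u,h\},\{v,h\}\in E_G$ both of label $<k$. $\lambda$ is an MAT-labeling (and $(G,\lambda)$ an MAT-labeled graph) if for every $k\in\mathbb{Z}_{>0}$: (ML1) no edge $e\in\pi_{\le k}$ forms a cycle with edges in $\pi_k$; (ML2) every edge in $\pi_k$ has exactly $k-1$ conditioning vertices. For $e=\{i,j\}\in\pi_k$ with conditioning vertices $h_1,\dots,h_{k-1}$, the principal clique generated by $e$ is $K_e=\{i,j,h_1,\dots,h_{k-1}\}$; the principal cliques of $(G,\lambda)$ are the sets $K_e$, $e\in E_G$. Posets are finite. A graded poset has rank function $\operatorname{rk}$ with $x<y\Rightarrow \operatorname{rk}(x)<\operatorname{rk}(y)$, $\operatorname{rk}(y)=\operatorname{rk}(x)+1$ when $y$ covers $x$, and minimal elements of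 rank $1$; $\mathcal{P}_i$ = elements of rank $i$, $\dim(\mathcal{P})$ = number of minimal elements, $\mathcal{E}(v)$ = set of elements covered by $v$. A vine is a graded poset in which every non-minimal element covers exactly two elements, any two distinct elements of the same rank are covered by at most one common element, and for each $1\le i\le\operatorname{rk}(\mathcal{P})$ the graph $F_i$ on $\mathcal{P}_i$ with edge set $\{\mathcal{E}(v)\mid v\in\mathcal{P}_{i+1}\}$ is a forest. An R-vine is a vine with $\operatorname{rk}(\mathcal{P})=\dim(\mathcal{P})$, each $F_i$ a tree, and proximity: distinct elements of the same rank $i\ge2$ covered by a common element cover a common element. An LR-vine is a vine all of whose principal ideals $\mathcal{P}_{\le v}$ (induced order and rank) are R-vines. -}

module Defs where

open import Data.Nat using (ℕ; suc; _≤_; _<_; _∸_)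
open import Data.Fin using (Fin)
open import Data.Fin.Subset using (Subset; ⁅_⁆; _⊆_; ∣_∣) renaming (_∈_ to _∈ₛ_)
open import Data.List using (List; []; _∷_; _++_; length)
open import Data.List.Membership.Propositional using (_∈_)
open import Data.List.Relation.Unary.All using (All)
open import Data.List.Relation.Unary.Unique.Propositional using (Unique)
open import Data.List.Relation.Unary.Linked using (Linked)
open import Data.Product using (Σ; ∃; ∃₂; _×_)
open import Data.Sum using (_⊎_)
open import Relation.Nullary using (¬_; Dec)
open import Relation.Binary.PropositionalEquality using (_≡_; _≢_)
open import Relation.Binary.Construct.Closure.ReflexiveTransitive using (Star)

Card : {A : Set} → (A → Set) → ℕ → Set
Card {A} P n = Σ (List A) λ xs →
  Unique xs × All P xs × (∀ x → P x → x ∈ xs) × length xs ≡ n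

-- Edge-labeled (finite, simple, undirected) graphs on vertex set Fin ℓ
-- (i.e. [ℓ]).  Labels are only meaningful on edges; they must be positive.

record LabeledGraph (ℓ : ℕ) : Set₁ where
  field
    E       : Fin ℓ → Fin ℓ → Set
    E?      : ∀ i j → Dec (E i j)
    irrefl  : ∀ i → ¬ E i i
    E-sym   : ∀ i j → E i j → E j i
    lab     : Fin ℓ → Fin ℓ → ℕ
    lab-sym : ∀ i j → lab i j ≡ lab j i
    lab-pos : ∀ i j → E i j → 1 ≤ lab i j

module _ {ℓ : ℕ} (G : LabeledGraph ℓ) where
  open LabeledGraph G

  Conditioning : Fin ℓ → Fin ℓ → Fin ℓ → Set
  Conditioning i j h = E i h × E j h × lab i h < lab i j × lab j h < lab i j

  InPi : ℕ → Fin ℓ → Fin ℓ → Set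
  InPi k a b = E a b × lab a b ≡ k

  -- (ML1): no edge {u,v} of label ≤ k forms a (simple) cycle with edges
  -- of π_k, i.e. there is no simple path u, m₁, …, m_r, v (r ≥ 1) all of
  -- whose edges are in π_k.
  ML1 : Set
  ML1 = ∀ k u v → E u v → lab u v ≤ k → ¬ (Σ (List (Fin ℓ)) λ mid →
          1 ≤ length mid × Unique (u ∷ mid ++ v ∷ []) ×
          Linked (InPi k) (u ∷ mid ++ v ∷ []))

  ML2 : Set
  ML2 = ∀ i j → E i j → Card (Conditioning i j) (lab i j ∸ 1)

  IsMAT : Set
  IsMAT = ML1 × ML2

  IsPrincipalCliqueOf : Fin ℓ → Fin ℓ → Subset ℓ → Set
  IsPrincipalCliqueOf i j S =
    ∀ h → (h ∈ₛ S → (h ≡ i ⊎ h ≡ j ⊎ Conditioning i j h)) ×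
          ((h ≡ i ⊎ h ≡ j ⊎ Conditioning i j h) → h ∈ₛ S)

  InP : Subset ℓ → Set
  InP S = (∃ λ i → S ≡ ⁅ i ⁆) ⊎ (∃₂ λ i j → E i j × IsPrincipalCliqueOf i j S)

  IsComplete : Set
  IsComplete = ∀ i j → i ≢ j → E i j

module Vines {A : Set} (In : A → Set) (_≤ₚ_ : A → A → Set) (rk : A → ℕ) where

  _≺_ : A → A → Set
  x ≺ y = x ≤ₚ y × x ≢ y

  IsPoset : Set
  IsPoset = (∀ x → In x → x ≤ₚ x)
          × (∀ x y → In x → In y → x ≤ₚ y → y ≤ₚ x → x ≡ y)
          × (∀ x y z → In x → In y → In z → x ≤ₚ y → y ≤ₚ z → x ≤ₚ z)

  Minimal : A → Set
  Minimal x = In x × (∀ y → In y → ¬ (y ≺ x))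

  _⋖_ : A → A → Set
  x ⋖ y = In x × In y × x ≺ y × (∀ z → In z → ¬ (x ≺ z × z ≺ y))

  IsGraded : Set
  IsGraded = (∀ x y → In x → In y → x ≺ y → rk x < rk y)
           × (∀ x y → x ⋖ y → rk y ≡ suc (rk x))
           × (∀ x → Minimal x → rk x ≡ 1)

  Vert : ℕ → A → Set
  Vert i x = In x × rk x ≡ i

  FEdge : ℕ → A → A → Set
  FEdge i x y = rk x ≡ i × rk y ≡ i × x ≢ y ×
                ∃ λ v → rk v ≡ suc i × x ⋖ v × y ⋖ v

  HasCycle : (A → A → Set) → Set
  HasCycle R = ∃₂ λ x rest → 2 ≤ length rest × Unique (x ∷ rest) ×
               Linked R (x ∷ rest ++ x ∷ [])

  IsForest : ℕ → Set
  IsForest i = ¬ HasCycle (FEdge i)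

  IsTree : ℕ → Set
  IsTree i = IsForest i × (∀ x y → Vert i x → Vert i y → Star (FEdge i) x y)

  -- 1 ≤ i ≤ rk(𝒫), where rk(𝒫) is the maximal rank of an element
  InRange : ℕ → Set
  InRange i = 1 ≤ i × ∃ λ x → In x × i ≤ rk x

  -- rk(𝒫) = r  (convention: the empty poset has rank 0)
  RankIs : ℕ → Set
  RankIs r = (∀ x → In x → rk x ≤ r)
           × ((r ≡ 0 × (∀ x → ¬ In x)) ⊎ (∃ λ x → In x × rk x ≡ r))

  DimIs : ℕ → Set
  DimIs d = Card Minimal d

  IsVine : Set
  IsVine = IsPoset × IsGraded
         × (∀ v → In v → ¬ Minimal v →
              ∃₂ λ x y → x ≢ y × x ⋖ v × y ⋖ v × (∀ z → z ⋖ v → z ≡ x ⊎ z ≡ y))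
         × (∀ x y v w → rk x ≡ rk y → x ≢ y →
              x ⋖ v → y ⋖ v → x ⋖ w → y ⋖ w → v ≡ w)
         × (∀ i → InRange i → IsForest i)

  Proximity : Set
  Proximity = ∀ x y v → 2 ≤ rk x → rk x ≡ rk y → x ≢ y →
              x ⋖ v → y ⋖ v → ∃ λ z → z ⋖ x × z ⋖ y

  IsRVine : Set
  IsRVine = IsVine × (∃ λ r → RankIs r × DimIs r)
          × (∀ i → InRange i → IsTree i) × Proximity

IsLRVine : {A : Set} → (A → Set) → (A → A → Set) → (A → ℕ) → Set
IsLRVine In _≤ₚ_ rk =
  Vines.IsVine In _≤ₚ_ rk ×
  (∀ v → In v → Vines.IsRVine (λ y → In y × y ≤ₚ v) _≤ₚ_ rk)

IsRVine : {A : Set} → (A → Set) → (A → A → Set) → (A → ℕ) → Set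
IsRVine = Vines.IsRVine

{-# OPTIONS --safe #-}

-- The graphs G_{<m} of edges of label < m are chordal.  Adding the edges of label m one at a time, a new chordless cycle would
-- consist of an edge ab and an induced path from a to b; the m - 1 conditioning vertices of ab are then adjacent to the whole path,
-- which contradicts (ML1), (ML2) or the bound m on the size of cliques with labels < m.
-- Chordality makes each principal clique a clique in which only the generating edge ij has the maximal label k.  Counting with
-- (ML2), removing i, removing j and removing both again gives principal cliques, and these are the only elements covered below.
-- Covering relations, proximity and connectedness of the graphs F_k follow; F_k is a forest since a cycle in it projects to a
-- cycle in the forest π_k.

module Submission where

open import Defs
open import Data.Bool.Properties using () renaming (_≟_ to _≟ᵇ_)
open import Data.Empty using (⊥; ⊥-elim)
open import Data.Fin using (Fin; zero; suc; _≟_)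
open import Data.Fin.Properties using (injective⇒≤) renaming (suc-injective to suc-injectiveᶠ)
open import Data.Fin.Subset using (Subset; ⁅_⁆; ∣_∣; _-_; _⊆_; inside; outside)
  renaming (_∈_ to _∈ₛ_; _∉_ to _∉ₛ_; ⊤ to full)
open import Data.Fin.Subset.Properties
  using (x∈⁅x⁆; x∈⁅y⁆⇒x≡y; ∣⁅x⁆∣≡1; ⊆-antisym; ⊆-refl; ⊆-trans; ⊆⊤; ∈⊤; p⊆q⇒∣p∣≤∣q∣; p─q⊆p; x∈p∧x≢y⇒x∈p-y; p─x─y≡p─y─x; _∈?_)
open import Data.List using (List; []; _∷_; _++_; length; lookup; map; allFin; cartesianProduct)
open import Data.List.Membership.Propositional using (_∈_; _∉_; find)
open import Data.List.Membership.Propositional.Properties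
  using (∈-lookup; ∈-map⁺; ∈-allFin; ∈-cartesianProduct⁺; ∈-cartesianProduct⁻)
import Data.List.Membership.Setoid.Properties as Membershipₛ
open import Data.List.Properties using (length-map)
open import Data.List.Relation.Binary.Subset.Propositional using () renaming (_⊆_ to _⊆ˡ_)
open import Data.List.Relation.Unary.All as All using (All; []; _∷_)
import Data.List.Relation.Unary.All.Properties as Allₚ
open import Data.List.Relation.Unary.AllPairs using ([]; _∷_)
open import Data.List.Relation.Unary.Any as Any using (here; there)
open import Data.List.Relation.Unary.Linked as Linked using (Linked; [-]; _∷_)
open import Data.List.Relation.Unary.Unique.Propositional using (Unique)
open import Data.List.Relation.Unary.Unique.Propositional.Properties using (map⁺; allFin⁺)
open import Data.Nat using (ℕ; zero; suc; _≤_; _<_; z≤n; s≤s; s≤s⁻¹)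
open import Data.Nat.Properties
  using (≤-trans; ≤-refl; ≤-reflexive; ≤-antisym; ≤-totalOrder; <-irrefl; <⇒≤; ≤∧≢⇒<; <-≤-trans; ≤-<-trans; ≮⇒≥; ≰⇒>; _<?_;
         m≤n⇒m<n∨m≡n; m+[n∸m]≡n; n<1+n; suc-injective)
  renaming (_≟_ to _≟ℕ_)
open import Data.List.Extrema ≤-totalOrder using (argmax; argmax-sel; f[xs]≤f[argmax])
open import Data.Product using (Σ; ∃₂; ∃-syntax; _×_; _,_; proj₁; proj₂)
open import Data.Sum as Sum using (_⊎_; inj₁; inj₂)
open import Data.Unit using (⊤; tt)
open import Data.Vec using ([]; _∷_; here; there)
open import Data.Vec.Properties using (≡-dec)
open import Function using (_∘_; id)
open import Relation.Binary.Construct.Closure.ReflexiveTransitive as Star using (Star; ε; _◅_; _◅◅_)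
open import Relation.Binary.Definitions using (DecidableEquality)
open import Relation.Binary.PropositionalEquality
open import Relation.Nullary using (¬_; Dec; yes; no; contradiction)
open import Relation.Nullary.Decidable using (_×-dec_; _⊎-dec_; ¬?)

-- Counting with duplicate-free lists.

module _ {A : Set} where

  lookup-injective : {xs : List A} → Unique xs → ∀ i j → lookup xs i ≡ lookup xs j → i ≡ j
  lookup-injective (_ ∷ _) zero zero _ = refl
  lookup-injective {x ∷ xs} (x∉ ∷ _) zero (suc j) eq = contradiction eq (All.lookup x∉ (∈-lookup j))
  lookup-injective {x ∷ xs} (x∉ ∷ _) (suc i) zero eq = contradiction (sym eq) (All.lookup x∉ (∈-lookup i))
  lookup-injective (_ ∷ u) (suc i) (suc j) eq = cong suc (lookup-injective u i j eq)

  unique-⊆⇒length≤ : {xs ys : List A} → Unique xs → xs ⊆ˡ ys → length xs ≤ length ys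
  unique-⊆⇒length≤ {xs} uxs xs⊆ys = injective⇒≤ {f = λ i → Any.index (xs⊆ys (∈-lookup {xs = xs} i))} λ {i} {j} eq →
    lookup-injective uxs i j (Membershipₛ.index-injective (setoid A) (xs⊆ys (∈-lookup i)) (xs⊆ys (∈-lookup j)) eq)

  unique-∷ : ∀ {x} {xs : List A} → x ∉ xs → Unique xs → Unique (x ∷ xs)
  unique-∷ x∉xs uxs = Allₚ.¬Any⇒All¬ _ x∉xs ∷ uxs

  module _ (_≟ᴬ_ : DecidableEquality A) where
    open import Data.List.Membership.DecPropositional _≟ᴬ_ using () renaming (_∈?_ to _∈ˡ?_)

    unique-⊆∧length≥⇒⊇ : {xs ys : List A} → Unique xs → xs ⊆ˡ ys → length ys ≤ length xs → ys ⊆ˡ xs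
    unique-⊆∧length≥⇒⊇ {xs} uxs xs⊆ys ys≤xs {y} y∈ys with y ∈ˡ? xs
    ... | yes y∈xs = y∈xs
    ... | no  y∉xs = contradiction
      (≤-trans (unique-⊆⇒length≤ (unique-∷ y∉xs uxs) λ { (here refl) → y∈ys ; (there z) → xs⊆ys z }) ys≤xs)
      (<-irrefl refl)

module _ {A : Set} {P : A → Set} where

  card-unique : ∀ {m n} → Card P m → Card P n → m ≡ n
  card-unique (xs , uxs , pxs , cxs , refl) (ys , uys , pys , cys , refl) =
    ≤-antisym (unique-⊆⇒length≤ uxs λ z → cys _ (All.lookup pxs z)) (unique-⊆⇒length≤ uys λ z → cxs _ (All.lookup pys z))

-- Walks, induced paths and chordality.

module Walks {V : Set} (R : V → V → Set) where

  Out : V → V → Set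
  Out v z = z ≢ v × ¬ R v z

  -- `Q` restricts only the inner vertices, since the ends of the walks in `Chordal` are themselves
  -- neighbours of the centre.
  data Walk (Q : V → Set) : V → V → Set where
    edge : ∀ {x y} → R x y → Walk Q x y
    cons : ∀ {x y z} → R x y → Q y → Walk Q y z → Walk Q x z

  -- Equivalent to the absence of induced cycles of length ≥ 4: v would be the vertex between x and y on such a cycle.
  Chordal : Set
  Chordal = ∀ {v x y} → R v x → R v y → Walk (Out v) x y → x ≡ y ⊎ R x y

  append : ∀ {Q x y z} → Walk Q x y → Q y → Walk Q y z → Walk Q x z
  append (edge r) q w = cons r q w
  append (cons r q′ w′) q w = cons r q′ (append w′ q w)

  mapWalk : ∀ {Q Q′} → (∀ {z} → Q z → Q′ z) → ∀ {x y} → Walk Q x y → Walk Q′ x y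
  mapWalk f (edge r) = edge r
  mapWalk f (cons r q w) = cons r (f q) (mapWalk f w)

  module _ (R-sym : ∀ {x y} → R x y → R y x) where

    reverse : ∀ {Q x y} → Walk Q x y → Walk Q y x
    reverse (edge r) = edge (R-sym r)
    reverse (cons r q w) = append (reverse w) q (edge (R-sym r))

  mutual
    -- `Tail` skips the first vertex of a path. So each vertex is adjacent to its successor and
    -- `Out` for all later ones: the path is chordless, and simple if `R` is irreflexive.
    data Induced (b : V) : V → Set where
      stop : Induced b b
      step : ∀ {u w} → R u w → (p : Induced b w) → Tail (Out u) p → Induced b u

    Tail : (V → Set) → ∀ {b u} → Induced b u → Set
    Tail Q stop = ⊤
    Tail Q (step {w = w} _ p _) = Q w × Tail Q p

  mapTail : ∀ {Q Q′ : V → Set} → (∀ {z} → Q z → Q′ z) → ∀ {b u} (p : Induced b u) → Tail Q p → Tail Q′ p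
  mapTail f stop _ = tt
  mapTail f (step _ p _) (q , t) = f q , mapTail f p t

  toWalk : ∀ {Q b u h} (p : Induced b u) → Tail Q p → R b h → Walk Q u h
  toWalk stop _ r = edge r
  toWalk (step r′ p _) (q , t) r = cons r′ q (toWalk p t r)

  module _ (_≟ⱽ_ : DecidableEquality V) (R? : ∀ x y → Dec (R x y)) where

    -- The search starts at the far end `b`. At the last vertex equal or adjacent to `u` everything
    -- before it is dropped; what follows is already known to be `Out u`. The first vertex of `p` is
    -- not tested, because `attach` supplies the edge to it.
    shortcut : ∀ {Q b w} u (p : Induced b w) → Tail Q p → (Σ (Induced b u) (Tail Q)) ⊎ Tail (Out u) p
    shortcut u stop _ = inj₂ tt
    shortcut u (step {w = w} _ p _) (q , t) with shortcut u p t
    ... | inj₁ r = inj₁ r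
    ... | inj₂ out with w ≟ⱽ u
    ...   | yes refl = inj₁ (p , t)
    ...   | no w≢u with R? u w
    ...     | yes r = inj₁ (step r p out , q , t)
    ...     | no ¬r = inj₂ ((w≢u , ¬r) , out)

    attach : ∀ {Q b u w} → R u w → (p : Induced b w) → Q w → Tail Q p → Σ (Induced b u) (Tail Q)
    attach {u = u} r p q t with shortcut u p t
    ... | inj₁ p′ = p′
    ... | inj₂ out = step r p out , q , t

    walk⇒induced : ∀ {Q x b} → Walk Q x b → Q b → Σ (Induced b x) (Tail Q)
    walk⇒induced (edge r) q = attach r stop q tt
    walk⇒induced (cons r q w) qb = let p , t = walk⇒induced w qb in attach r p q t

    star⇒induced : ∀ {x b} → Star R x b → Induced b x
    star⇒induced ε = stop
    star⇒induced (r ◅ rs) = proj₁ (attach {Q = λ _ → ⊤} r p tt (all⊤ p))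
      where
      p = star⇒induced rs
      all⊤ : ∀ {b u} (p : Induced b u) → Tail (λ _ → ⊤) p
      all⊤ stop = tt
      all⊤ (step _ p _) = tt , all⊤ p

  vertices : ∀ {b u} → Induced b u → List V
  vertices {b} stop = b ∷ []
  vertices {b} {u} (step _ p _) = u ∷ vertices p

  tail⇒all : ∀ {Q b u} → Q u → (p : Induced b u) → Tail Q p → All Q (vertices p)
  tail⇒all q stop _ = q ∷ []
  tail⇒all q (step _ p _) (q′ , t) = q ∷ tail⇒all q′ p t

  vertices-linked : ∀ {b u} (p : Induced b u) → Linked R (vertices p)
  vertices-linked stop = [-]
  vertices-linked (step r stop _) = r ∷ [-]
  vertices-linked (step r p@(step _ _ _) _) = r ∷ vertices-linked p

  vertices-unique : (∀ x → ¬ R x x) → ∀ {b u} (p : Induced b u) → Unique (vertices p)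
  vertices-unique irr stop = [] ∷ []
  vertices-unique irr (step {u} r p out) =
    All.map (λ ne eq → ne (sym eq)) (tail⇒all (λ { refl → irr _ r }) p (mapTail proj₁ p out)) ∷ vertices-unique irr p

  vertices-ends : ∀ {b u} (p : Induced b u) → u ≢ b → ∃[ mid ] vertices p ≡ u ∷ mid ++ b ∷ []
  vertices-ends stop u≢b = contradiction refl u≢b
  vertices-ends (step r stop _) u≢b = [] , refl
  vertices-ends (step {w = w} r p@(step r′ p′ out) _) u≢b with vertices-ends′ p
    where
    vertices-ends′ : ∀ {b u} (p : Induced b u) → ∃[ mid ] vertices p ≡ mid ++ b ∷ []
    vertices-ends′ stop = [] , refl
    vertices-ends′ (step {u} _ p _) = let m , eq = vertices-ends′ p in u ∷ m , cong (u ∷_) eq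
  ... | mid , eq = mid , cong (_ ∷_) eq

argmax-∈ : {A : Set} (f : A → ℕ) {xs : List A} {x : A} → x ∈ xs → ∃[ y ] y ∈ xs × (∀ {z} → z ∈ xs → f z ≤ f y)
argmax-∈ f {xs} {x} x∈xs = argmax f x xs , y∈xs , All.lookup (f[xs]≤f[argmax] {f = f} x xs)
  where
  y∈xs : argmax f x xs ∈ xs
  y∈xs with argmax-sel f x xs
  ... | inj₁ eq = subst (_∈ xs) (sym eq) x∈xs
  ... | inj₂ y∈ = y∈

chordal-resp : {V : Set} {R S : V → V → Set} → (∀ {x y} → R x y → S x y) → (∀ {x y} → S x y → R x y) →
  Walks.Chordal R → Walks.Chordal S
chordal-resp {R = R} {S} R⇒S S⇒R ch vx vy walk = Sum.map₂ R⇒S (ch (S⇒R vx) (S⇒R vy) (convert walk))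
  where
  open Walks
  convert : ∀ {v x y} → Walk S (Out S v) x y → Walk R (Out R v) x y
  convert (edge r) = edge (S⇒R r)
  convert (cons r (ne , ¬s) w) = cons (S⇒R r) (ne , ¬s ∘ R⇒S) (convert w)

SamePair : {A : Set} → A → A → A → A → Set
SamePair x y a b = (x ≡ a × y ≡ b) ⊎ (x ≡ b × y ≡ a)

samePair? : ∀ {n} (x y a b : Fin n) → Dec (SamePair x y a b)
samePair? x y a b = ((x ≟ a) ×-dec (y ≟ b)) ⊎-dec ((x ≟ b) ×-dec (y ≟ a))

-- Cardinalities of subsets of a finite set.

card-subset : ∀ {n} (S : Subset n) → Card (_∈ₛ S) ∣ S ∣
card-subset [] = [] , [] , [] , (λ _ ()) , refl
card-subset (s ∷ S) with card-subset S
card-subset (inside ∷ S) | xs , uxs , pxs , cxs , eq =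
    zero ∷ map suc xs
  , Allₚ.map⁺ (All.universal (λ _ ()) xs) ∷ map⁺ suc-injectiveᶠ uxs
  , here ∷ Allₚ.map⁺ (All.map there pxs)
  , (λ { zero _ → here refl ; (suc i) (there i∈) → there (∈-map⁺ suc (cxs i i∈)) })
  , cong suc (trans (length-map suc xs) eq)
card-subset (outside ∷ S) | xs , uxs , pxs , cxs , eq =
    map suc xs
  , map⁺ suc-injectiveᶠ uxs
  , Allₚ.map⁺ (All.map there pxs)
  , (λ { (suc i) (there i∈) → ∈-map⁺ suc (cxs i i∈) })
  , trans (length-map suc xs) eq

module _ {n : ℕ} where

  size≡length : ∀ {S : Subset n} {xs} → Unique xs → (∀ {h} → h ∈ₛ S → h ∈ xs) → (∀ {h} → h ∈ xs → h ∈ₛ S) → ∣ S ∣ ≡ length xs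
  size≡length {S} {xs} uxs S⇒xs xs⇒S = card-unique (card-subset S) (xs , uxs , All.tabulate xs⇒S , (λ _ → S⇒xs) , refl)

  ⊆∧size≥⇒≡ : ∀ {p q : Subset n} → p ⊆ q → ∣ q ∣ ≤ ∣ p ∣ → p ≡ q
  ⊆∧size≥⇒≡ {p} {q} p⊆q q≤p with card-subset p | card-subset q
  ... | xs , uxs , pxs , cxs , eqx | ys , uys , pys , cys , eqy =
    ⊆-antisym p⊆q λ h∈q → All.lookup pxs
      (unique-⊆∧length≥⇒⊇ _≟_ uxs (λ h∈ → cys _ (p⊆q (All.lookup pxs h∈))) (subst₂ _≤_ (sym eqy) (sym eqx) q≤p) (cys _ h∈q))

  ⁅⁆-injective : ∀ {i j : Fin n} → ⁅ i ⁆ ≡ ⁅ j ⁆ → i ≡ j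
  ⁅⁆-injective {i} {j} eq = x∈⁅y⁆⇒x≡y j (subst (i ∈ₛ_) eq (x∈⁅x⁆ i))

  p-x⊆p : ∀ (p : Subset n) x → p - x ⊆ p
  p-x⊆p p x = p─q⊆p p ⁅ x ⁆

x∉p-x : ∀ {n} (p : Subset n) x → x ∉ₛ p - x
x∉p-x (_ ∷ _) zero ()
x∉p-x (_ ∷ p) (suc x) (there x∈) = x∉p-x p x x∈

∈-⇒≢ : ∀ {n} {p : Subset n} {x y} → x ∈ₛ p - y → x ≢ y
∈-⇒≢ {p = p} x∈ refl = x∉p-x p _ x∈

-- First consequences of (ML1) and (ML2) for cliques.

module MAT {ℓ : ℕ} (G : LabeledGraph ℓ) (mat : IsMAT G) where
  open LabeledGraph G

  V : Set
  V = Fin ℓ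

  Cond : V → V → V → Set
  Cond = Conditioning G

  E-swap : ∀ {i j} → E i j → E j i
  E-swap = E-sym _ _

  E⇒≢ : ∀ {i j} → E i j → i ≢ j
  E⇒≢ e refl = irrefl _ e

  Cond-swap : ∀ {i j h} → Cond i j h → Cond j i h
  Cond-swap {i} {j} (eᵢ , eⱼ , lᵢ , lⱼ) = eⱼ , eᵢ , <-≤-trans lⱼ (≤-reflexive (lab-sym i j)) , <-≤-trans lᵢ (≤-reflexive (lab-sym i j))

  InPi-sym : ∀ {k i j} → InPi G k i j → InPi G k j i
  InPi-sym (e , l) = E-swap e , trans (lab-sym _ _) l

  InPi? : ∀ k i j → Dec (InPi G k i j)
  InPi? k i j = E? i j ×-dec (lab i j ≟ℕ k)

  -- The shortest case of (ML1): two edges of label `k` with a common end can only be completed to a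
  -- triangle by an edge of larger label.
  no-triangle : ∀ {k u w v} → InPi G k u w → InPi G k w v → E u v → lab u v ≤ k → ⊥
  no-triangle {w = w} uw wv uv l = proj₁ mat _ _ _ uv l
    (w ∷ [] , s≤s z≤n
    , ((E⇒≢ (proj₁ uw) ∷ E⇒≢ uv ∷ []) ∷ (E⇒≢ (proj₁ wv) ∷ []) ∷ [] ∷ [])
    , uw ∷ wv ∷ [-])

  -- Shortening the walk to an induced path makes it simple, and `¬ R u v` gives it an inner vertex,
  -- as (ML1) demands. `R` may be a proper part of π_k, so that `uv` itself can be left out when it
  -- has label `k`.
  no-detour : ∀ {k u v} → E u v → lab u v ≤ k →
    (R : V → V → Set) → (∀ x y → Dec (R x y)) → (∀ {x y} → R x y → InPi G k x y) →
    ¬ R u v → ¬ Star R u v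
  no-detour {k} {u} {v} uv l R R? R⊆π ¬Ruv p = contradict (vertices-ends q (E⇒≢ uv))
    where
    open Walks R
    q = star⇒induced _≟_ R? p
    linked = vertices-linked q
    unique = vertices-unique (λ x r → irrefl x (proj₁ (R⊆π r))) q
    contradict : ¬ (∃[ mid ] vertices q ≡ u ∷ mid ++ v ∷ [])
    contradict ([] , eq) = ¬Ruv (Linked.head (subst (Linked R) eq linked))
    contradict (mid@(_ ∷ _) , eq) = proj₁ mat k u v uv l
      (mid , s≤s z≤n , subst Unique eq unique , Linked.map R⊆π (subst (Linked R) eq linked))

  InClique : V → V → V → Set
  InClique i j h = h ≡ i ⊎ h ≡ j ⊎ Cond i j h

  module _ {i j : V} (e : E i j) where

    conds : List V
    conds = proj₁ (proj₂ mat i j e)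

    conds-unique : Unique conds
    conds-unique = proj₁ (proj₂ (proj₂ mat i j e))

    ∈-conds⁻ : ∀ {h} → h ∈ conds → Cond i j h
    ∈-conds⁻ = All.lookup (proj₁ (proj₂ (proj₂ (proj₂ mat i j e))))

    ∈-conds⁺ : ∀ {h} → Cond i j h → h ∈ conds
    ∈-conds⁺ = proj₁ (proj₂ (proj₂ (proj₂ (proj₂ mat i j e)))) _

    1+length-conds : suc (length conds) ≡ lab i j
    1+length-conds = trans (cong suc (proj₂ (proj₂ (proj₂ (proj₂ (proj₂ mat i j e))))))
                           (m+[n∸m]≡n (lab-pos i j e))

    clique : List V
    clique = i ∷ j ∷ conds

    length-clique : length clique ≡ suc (lab i j)
    length-clique = cong suc 1+length-conds

    ∉-conds : ∀ {h} → ¬ Cond i j h → h ∉ conds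
    ∉-conds ¬c = ¬c ∘ ∈-conds⁻

    clique-unique : Unique clique
    clique-unique =
      unique-∷ (λ { (here i≡j) → E⇒≢ e i≡j ; (there i∈) → irrefl _ (proj₁ (∈-conds⁻ i∈)) })
      (unique-∷ (∉-conds λ c → irrefl _ (proj₁ (proj₂ c))) conds-unique)

    ∈-clique⁻ : ∀ {h} → h ∈ clique → InClique i j h
    ∈-clique⁻ (here h≡i) = inj₁ h≡i
    ∈-clique⁻ (there (here h≡j)) = inj₂ (inj₁ h≡j)
    ∈-clique⁻ (there (there h∈)) = inj₂ (inj₂ (∈-conds⁻ h∈))

    ∈-clique⁺ : ∀ {h} → InClique i j h → h ∈ clique
    ∈-clique⁺ (inj₁ h≡i) = here h≡i
    ∈-clique⁺ (inj₂ (inj₁ h≡j)) = there (here h≡j)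
    ∈-clique⁺ (inj₂ (inj₂ c)) = there (there (∈-conds⁺ c))

    -- (ML2) as an upper bound; the contradictions by counting rest on it.
    length≤clique : ∀ {xs} → Unique xs → (∀ {h} → h ∈ xs → InClique i j h) → length xs ≤ suc (lab i j)
    length≤clique uxs f = ≤-trans (unique-⊆⇒length≤ uxs (∈-clique⁺ ∘ f)) (≤-reflexive length-clique)

  IsClique : List V → Set
  IsClique xs = ∀ {u v} → u ∈ xs → v ∈ xs → u ≢ v → E u v

  -- The diagonal gets 0, which is below every label, so a pair of largest weight in a clique with
  -- at least two vertices is an edge.
  weight : V × V → ℕ
  weight (u , v) with u ≟ v
  ... | yes _ = 0
  ... | no  _ = lab u v

  weight-≢ : ∀ {u v} → u ≢ v → weight (u , v) ≡ lab u v
  weight-≢ {u} {v} u≢v with u ≟ v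
  ... | yes u≡v = contradiction u≡v u≢v
  ... | no  _ = refl

  weight-pos : ∀ {u v} → 1 ≤ weight (u , v) → u ≢ v
  weight-pos {u} {v} _ with u ≟ v
  weight-pos () | yes _
  ... | no u≢v = u≢v

  -- The edges of maximal label in a clique form a matching by (ML1), so all other vertices are conditioning for such an edge.
  clique-generator : ∀ {x y rest} → Unique (x ∷ y ∷ rest) → IsClique (x ∷ y ∷ rest) →
    ∃₂ λ u v → u ∈ x ∷ y ∷ rest × v ∈ x ∷ y ∷ rest × E u v × (∀ {h} → h ∈ x ∷ y ∷ rest → InClique u v h)
  clique-generator {x} {y} {rest} ((x≢y ∷ _) ∷ _) cl =
    generator (here refl) (there (here refl)) x≢y cl (argmax-∈ weight (∈-cartesianProduct⁺ {xs = x ∷ y ∷ rest} {x ∷ y ∷ rest} (here refl) (there (here refl))))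
    where
    generator : ∀ {xs x y} → x ∈ xs → y ∈ xs → x ≢ y → IsClique xs →
      (∃[ t ] t ∈ cartesianProduct xs xs × (∀ {s} → s ∈ cartesianProduct xs xs → weight s ≤ weight t)) →
      ∃₂ λ u v → u ∈ xs × v ∈ xs × E u v × (∀ {h} → h ∈ xs → InClique u v h)
    generator {xs} {x} {y} x∈ y∈ x≢y cl ((u , v) , t∈ , max) = u , v , u∈ , v∈ , uv , generates
      where
      u∈ = proj₁ (∈-cartesianProduct⁻ xs xs t∈)
      v∈ = proj₂ (∈-cartesianProduct⁻ xs xs t∈)
      u≢v : u ≢ v
      u≢v = weight-pos (≤-trans (lab-pos x y (cl x∈ y∈ x≢y))
        (≤-trans (≤-reflexive (sym (weight-≢ x≢y))) (max (∈-cartesianProduct⁺ x∈ y∈))))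
      uv = cl u∈ v∈ u≢v
      maximal : ∀ {s t} → s ∈ xs → t ∈ xs → s ≢ t → lab s t ≤ lab u v
      maximal s∈ t∈ s≢t = subst₂ _≤_ (weight-≢ s≢t) (weight-≢ u≢v) (max (∈-cartesianProduct⁺ s∈ t∈))
      generates : ∀ {h} → h ∈ xs → InClique u v h
      generates {h} h∈ with h ≟ u | h ≟ v
      ... | yes h≡u | _ = inj₁ h≡u
      ... | no _ | yes h≡v = inj₂ (inj₁ h≡v)
      ... | no h≢u | no h≢v = inj₂ (inj₂
        ( uh , vh
        , ≤∧≢⇒< (maximal u∈ h∈ (h≢u ∘ sym)) (λ eq → no-triangle (InPi-sym (uh , eq)) (uv , refl) (E-swap vh) (maximal h∈ v∈ h≢v))
        , ≤∧≢⇒< (maximal v∈ h∈ (h≢v ∘ sym)) (λ eq → no-triangle (uv , refl) (vh , eq) uh (maximal u∈ h∈ (h≢u ∘ sym)))))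
        where
        uh = cl u∈ h∈ (h≢u ∘ sym)
        vh = cl v∈ h∈ (h≢v ∘ sym)

  -- Chordality of the graphs of edges with label below `m`.

  Low : ℕ → V → V → Set
  Low m x y = E x y × lab x y < m

  Low-sym : ∀ {m x y} → Low m x y → Low m y x
  Low-sym (e , l) = E-swap e , ≤-<-trans (≤-reflexive (lab-sym _ _)) l

  -- A clique with two or more vertices lies in the principal clique of one of its edges, whose size
  -- is one more than a label below `m`.
  clique-length≤ : ∀ {m xs} → 1 ≤ m → Unique xs →
    (∀ {u v} → u ∈ xs → v ∈ xs → u ≢ v → Low m u v) → length xs ≤ m
  clique-length≤ {xs = []} _ _ _ = z≤n
  clique-length≤ {xs = _ ∷ []} 1≤m _ _ = 1≤m
  clique-length≤ {xs = _ ∷ _ ∷ _} _ uxs cl =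
    let u , v , u∈ , v∈ , uv , gen = clique-generator uxs (λ p q ne → proj₁ (cl p q ne))
    in ≤-trans (length≤clique uv uxs gen) (proj₂ (cl u∈ v∈ (E⇒≢ uv)))

  open Walks using (Chordal; Out; Walk; edge; cons; append; mapWalk; reverse;
                    Induced; stop; step; Tail; mapTail; toWalk; walk⇒induced)

  -- Chordality with centre `a`, for the walk from `g` through `b` to `h`: the edge ab does not have
  -- a label below its own, so `b` is no neighbour of the centre.
  cond-clique : ∀ {a b g h} → Chordal (Low (lab a b)) → E a b → Cond a b g → Cond a b h → g ≢ h → Low (lab a b) g h
  cond-clique ch ab (ag , bg , lag , lbg) (ah , bh , lah , lbh) g≢h
    with ch (ag , lag) (ah , lah) (cons (Low-sym (bg , lbg)) (E⇒≢ (E-swap ab) , λ l → <-irrefl refl (proj₂ l)) (edge (bh , lbh)))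
  ... | inj₁ g≡h = contradiction g≡h g≢h
  ... | inj₂ gh = gh

  -- A stage in adding the edges of label `m` one at a time: a chordal graph between that of labels
  -- below `m` and that of labels at most `m`.
  record Layer (m : ℕ) : Set₁ where
    field
      Adj : V → V → Set
      Adj? : ∀ x y → Dec (Adj x y)
      Adj-sym : ∀ {x y} → Adj x y → Adj y x
      Adj⇒E : ∀ {x y} → Adj x y → E x y
      Adj⇒≤ : ∀ {x y} → Adj x y → lab x y ≤ m
      Low⇒Adj : ∀ {x y} → Low m x y → Adj x y
      chordal : Chordal Adj

  -- Adding one edge of label `m` to a layer.

  module NewEdge {m} (chordal< : Chordal (Low m)) (L : Layer m) where
    open Layer L

    module _ {a b} (πab : InPi G m a b) (¬ab : ¬ Adj a b) where
      private
        ab = proj₁ πab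

        cond⇒low : ∀ {h} → Cond a b h → Low m a h
        cond⇒low (ah , _ , l , _) = ah , <-≤-trans l (≤-reflexive (proj₂ πab))

        cond⇒lowʳ : ∀ {h} → Cond a b h → Low m b h
        cond⇒lowʳ (_ , bh , _ , l) = bh , <-≤-trans l (≤-reflexive (proj₂ πab))

        conds-low : ∀ {g h} → Cond a b g → Cond a b h → g ≢ h → Low m g h
        conds-low with refl ← proj₂ πab = cond-clique chordal< ab

        1≤m : 1 ≤ m
        1≤m = subst (1 ≤_) (proj₂ πab) (lab-pos a b ab)

        -- Only edges already in the layer count, so `ab` is left out, as `no-detour` requires.
        M : V → V → Set
        M x y = InPi G m x y × Adj x y

      -- All conditioning vertices of ab are adjacent to the current vertex u of an induced path from a to b.  Together with u and the
      -- next vertex w they exceed the bound on cliques with labels < m.  So either uw has label m and we go on along uw, eventually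
      -- closing a cycle in π_m, or wh has label m for some h, and then wh has too many conditioning vertices.
      no-induced-path : ∀ {u} (p : Induced Adj b u) → Tail Adj (λ z → ¬ Cond a b z) p → ¬ Cond a b u →
        (∀ {h} → Cond a b h → Low m u h) → Star M u a → ⊥
      no-induced-path stop _ _ _ star =
        -- The path has reached `b`, and the edges of label `m` traversed since `a` form a detour
        -- for ab.
        no-detour (E-swap ab) (≤-reflexive (trans (lab-sym _ _) (proj₂ πab))) M
          (λ x y → InPi? m x y ×-dec Adj? x y) proj₁ (¬ab ∘ Adj-sym ∘ proj₂) star
      no-induced-path (step {u} {w} uw p out) (w∉K , t) u∉K uK star = case-uw (lab u w ≟ℕ m)
        where
        E-uw = Adj⇒E uw

        wK : ∀ {h} → Cond a b h → Adj w h
        -- Chordality with centre `u`: the rest of the path and the edge from `b` to `h` join `w` to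
        -- `h`, and no inner vertex of this walk is a neighbour of `u`.
        wK c with chordal uw (Low⇒Adj (uK c)) (toWalk Adj p out (Low⇒Adj (cond⇒lowʳ c)))
        ... | inj₁ refl = contradiction c w∉K
        ... | inj₂ wh = wh

        too-many : ∀ {h} (p : Induced Adj b w) → Tail Adj (Out Adj u) p → Tail Adj (λ z → ¬ Cond a b z) p →
          Cond a b h → lab u w < m → lab w h ≢ m
        too-many stop _ _ ch _ wh≡m = <-irrefl wh≡m (proj₂ (cond⇒lowʳ ch))
        too-many {h} (step {w = x} wx p out-w) ((x≢u , _) , out-u) (x∉K , _) ch uw<m refl
          with chordal wx (wK ch) (toWalk Adj p out-w (Low⇒Adj (cond⇒lowʳ ch)))
        ... | inj₁ refl = x∉K ch
        -- `w`, `u`, `x` and the m - 1 conditioning vertices of ab, `h` among them, are m + 2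
        -- members of the principal clique of wh, which has only m + 1.
        ... | inj₂ xh = <-irrefl refl (≤-trans (s≤s (s≤s (≤-reflexive (sym (trans (1+length-conds ab) (proj₂ πab))))))
                                               (length≤clique wh unique cond))
          where
          wh = Adj⇒E (wK ch)
          hw : InPi G m h w
          hw = InPi-sym (wh , refl)
          strict : ∀ {z} → Adj w z → Adj h z → Cond w h z
          strict wz hz = Adj⇒E wz , Adj⇒E hz
            , ≤∧≢⇒< (Adj⇒≤ wz) (λ eq → no-triangle hw (Adj⇒E wz , eq) (Adj⇒E hz) (Adj⇒≤ hz))
            , ≤∧≢⇒< (Adj⇒≤ hz) (λ eq → no-triangle (wh , refl) (Adj⇒E hz , eq) (Adj⇒E wz) (Adj⇒≤ wz))
          unique : Unique (w ∷ u ∷ x ∷ conds ab)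
          unique =
            unique-∷ (λ { (here w≡u) → E⇒≢ E-uw (sym w≡u) ; (there (here w≡x)) → E⇒≢ (Adj⇒E wx) w≡x
                        ; (there (there w∈)) → ∉-conds ab w∉K w∈ })
            (unique-∷ (λ { (here u≡x) → x≢u (sym u≡x) ; (there u∈) → ∉-conds ab u∉K u∈ })
            (unique-∷ (∉-conds ab x∉K) (conds-unique ab)))
          cond : ∀ {z} → z ∈ w ∷ u ∷ x ∷ conds ab → InClique w h z
          cond (here z≡w) = inj₁ z≡w
          cond (there (here refl)) = inj₂ (inj₂ (strict (Adj-sym uw) (Adj-sym (Low⇒Adj (uK ch)))))
          cond (there (there (here refl))) = inj₂ (inj₂ (strict wx (Adj-sym xh)))
          cond {z} (there (there (there z∈))) with z ≟ h
          ... | yes z≡h = inj₂ (inj₁ z≡h)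
          ... | no z≢h = inj₂ (inj₂ (strict (wK (∈-conds⁻ ab z∈)) (Low⇒Adj (conds-low ch (∈-conds⁻ ab z∈) (z≢h ∘ sym)))))

        case-uw : Dec (lab u w ≡ m) → ⊥
        case-uw (yes uw≡m) = no-induced-path p t w∉K
          -- If wh also had label `m`, then uw and wh would form a forbidden triangle with uh.
          (λ c → Adj⇒E (wK c) , ≤∧≢⇒< (Adj⇒≤ (wK c)) λ wh≡m →
            no-triangle (E-uw , uw≡m) (Adj⇒E (wK c) , wh≡m) (proj₁ (uK c)) (<⇒≤ (proj₂ (uK c))))
          ((InPi-sym (E-uw , uw≡m) , Adj-sym uw) ◅ star)
        case-uw (no uw≢m) with All.all? (λ h → lab w h <? m) (conds ab)
        ... | no ¬all with h , h∈ , ¬l ← find (Allₚ.¬All⇒Any¬ (λ h → lab w h <? m) (conds ab) ¬all) =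
          too-many p out t (∈-conds⁻ ab h∈) (≤∧≢⇒< (Adj⇒≤ uw) uw≢m) (≤-antisym (Adj⇒≤ (wK (∈-conds⁻ ab h∈))) (≮⇒≥ ¬l))
        ... | yes all = <-irrefl refl (≤-trans (s≤s (≤-reflexive (sym (trans (1+length-conds ab) (proj₂ πab)))))
                                               (clique-length≤ 1≤m unique low))
          where
          low-uw : Low m u w
          low-uw = E-uw , ≤∧≢⇒< (Adj⇒≤ uw) uw≢m
          low-w : ∀ {h} → h ∈ conds ab → Low m w h
          low-w h∈ = Adj⇒E (wK (∈-conds⁻ ab h∈)) , All.lookup all h∈
          unique : Unique (u ∷ w ∷ conds ab)
          unique = unique-∷ (λ { (here u≡w) → E⇒≢ E-uw u≡w ; (there u∈) → ∉-conds ab u∉K u∈ })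
                   (unique-∷ (∉-conds ab w∉K) (conds-unique ab))
          low : ∀ {y z} → y ∈ u ∷ w ∷ conds ab → z ∈ u ∷ w ∷ conds ab → y ≢ z → Low m y z
          low (here refl) (here refl) ne = contradiction refl ne
          low (here refl) (there (here refl)) _ = low-uw
          low (here refl) (there (there z∈)) _ = uK (∈-conds⁻ ab z∈)
          low (there (here refl)) (here refl) _ = Low-sym low-uw
          low (there (here refl)) (there (here refl)) ne = contradiction refl ne
          low (there (here refl)) (there (there z∈)) _ = low-w z∈
          low (there (there y∈)) (here refl) _ = Low-sym (uK (∈-conds⁻ ab y∈))
          low (there (there y∈)) (there (here refl)) _ = Low-sym (low-w y∈)
          low (there (there y∈)) (there (there z∈)) ne = conds-low (∈-conds⁻ ab y∈) (∈-conds⁻ ab z∈) ne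

      -- Otherwise the walk shortens to an induced path from `a` through `x` to `b`. No vertex after
      -- `a` is a conditioning vertex of ab: `x` is not adjacent to `b`, and the later ones are not
      -- adjacent to `a`. So `no-induced-path` applies.
      first-step-adjacent : ∀ {x} → Adj a x → Walk Adj (Out Adj a) x b → Adj x b
      first-step-adjacent {x} ax walk with Adj? x b
      ... | yes xb = xb
      ... | no ¬xb = ⊥-elim (no-induced-path (step ax p t)
              ((λ c → ¬xb (Adj-sym (Low⇒Adj (cond⇒lowʳ c)))) , mapTail Adj (λ o c → proj₂ o (Low⇒Adj (cond⇒low c))) p t)
              (irrefl a ∘ proj₁) cond⇒low ε)
        where
        induced = walk⇒induced Adj _≟_ Adj? walk (E⇒≢ (E-swap ab) , ¬ab)
        p = proj₁ induced
        t = proj₂ induced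

  module AddEdge {m} (chordal< : Chordal (Low m)) (L : Layer m) where
    open Layer L
    open NewEdge chordal< L

    private
      Q : V → V → Set
      Q v = Out Adj v

      -- Allows the walk without edges, which `Walk` excludes. Otherwise `w` satisfies `P` too, so
      -- that the walk can be continued through `w`.
      Reach : (V → Set) → V → V → Set
      Reach P x w = x ≡ w ⊎ (P w × Walk Adj P x w)

      extend-reach : ∀ {P x w z} → Reach P x w → Adj w z → Walk Adj P x z
      extend-reach (inj₁ refl) r = edge r
      extend-reach (inj₂ (p , walk)) r = append Adj walk p (edge r)

    module _ {a b} (πab : InPi G m a b) (¬ab : ¬ Adj a b) where

      first-neighbour : ∀ {P w} → Walk Adj P w a → Q a w → ∃[ z ] P z × Adj a z × Walk Adj (Q a) w z
      first-neighbour (edge wa) (_ , ¬aw) = contradiction (Adj-sym wa) ¬aw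
      first-neighbour (cons {y = y} r p walk) out@(_ , ¬aw) with Adj? a y | y ≟ a
      ... | yes ay | _ = y , p , ay , edge r
      ... | no _ | yes refl = contradiction (Adj-sym r) ¬aw
      ... | no ¬ay | no y≢a =
        let z , pz , az , walk′ = first-neighbour walk (y≢a , ¬ay) in z , pz , az , cons r (y≢a , ¬ay) walk′

      -- The walk is cut at its first neighbour `z` of `a`. The part between `b` and `z` has no
      -- inner neighbour of `a`, so `first-step-adjacent` yields the edge from `z` to `b`.
      common-neighbour : ∀ {P} → Walk Adj P b a → ∃[ z ] P z × Adj a z × Adj b z
      common-neighbour walk =
        let z , pz , az , walk′ = first-neighbour walk (E⇒≢ (E-swap (proj₁ πab)) , ¬ab)
        in z , pz , az , Adj-sym (first-step-adjacent πab ¬ab az (reverse Adj Adj-sym walk′))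

      centre-at-end : ∀ {x y} → Adj a x ⊎ x ≡ b → Adj a y ⊎ y ≡ b → Walk Adj (Q a) x y → x ≡ y ⊎ Adj x y
      centre-at-end (inj₁ ax) (inj₁ ay) walk = chordal ax ay walk
      centre-at-end (inj₁ ax) (inj₂ refl) walk = inj₂ (first-step-adjacent πab ¬ab ax walk)
      centre-at-end (inj₂ refl) (inj₁ ay) walk = inj₂ (Adj-sym (first-step-adjacent πab ¬ab ay (reverse Adj Adj-sym walk)))
      centre-at-end (inj₂ refl) (inj₂ refl) walk = inj₁ refl

      -- The cycle through ab and v yields a common neighbour z of a and b, by which the edge ab can be bypassed.
      detour : ∀ {v x y} → Adj v x → Adj v y → Reach (Q v) x a → Reach (Q v) y b →
        (x ≡ y ⊎ Adj x y) ⊎ (x ≡ a × y ≡ b)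
      detour {v} {x} {y} vx vy xa yb with common-neighbour (append Adj (to-v yb) (inj₂ (inj₁ refl)) (from-v xa))
        where
        P : V → Set
        P z = Q v z ⊎ z ≡ v ⊎ z ≡ x ⊎ z ≡ y
        to-v : ∀ {w} → Reach (Q v) y w → Walk Adj P w v
        to-v (inj₁ refl) = edge (Adj-sym vy)
        to-v (inj₂ (_ , walk)) = append Adj (reverse Adj Adj-sym (mapWalk Adj inj₁ walk)) (inj₂ (inj₂ (inj₂ refl))) (edge (Adj-sym vy))
        from-v : ∀ {w} → Reach (Q v) x w → Walk Adj P v w
        from-v (inj₁ refl) = edge vx
        from-v (inj₂ (_ , walk)) = cons vx (inj₂ (inj₂ (inj₁ refl))) (mapWalk Adj inj₁ walk)
      ... | z , inj₁ qz , az , bz = inj₁ (chordal vx vy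
              (append Adj (extend-reach xa az) qz (reverse Adj Adj-sym (extend-reach yb bz))))
      ... | z , inj₂ (inj₂ (inj₁ refl)) , az , bz = inj₁ (Sum.map sym Adj-sym (chordal vy vx (extend-reach yb bz)))
      ... | z , inj₂ (inj₂ (inj₂ refl)) , az , bz = inj₁ (chordal vx vy (extend-reach xa az))
      -- Here `v` is adjacent to both `a` and `b`, so neither can be reached by a walk that avoids
      -- the neighbours of `v`, unless it is `x` or `y` itself.
      ... | z , inj₂ (inj₁ refl) , az , bz with xa | yb
      ...   | inj₁ x≡a | inj₁ y≡b = inj₂ (x≡a , y≡b)
      ...   | inj₂ ((_ , ¬va) , _) | _ = contradiction (Adj-sym az) ¬va
      ...   | inj₁ _ | inj₂ ((_ , ¬vb) , _) = contradiction (Adj-sym bz) ¬vb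

    meet : ∀ {v x y w} → Adj v x → Adj v y → Reach (Q v) x w → Reach (Q v) y w → x ≡ y ⊎ Adj x y
    meet vx vy (inj₁ refl) (inj₁ refl) = inj₁ refl
    meet vx vy (inj₁ refl) (inj₂ (_ , walk)) = chordal vx vy (reverse Adj Adj-sym walk)
    meet vx vy (inj₂ (_ , walk)) (inj₁ refl) = chordal vx vy walk
    meet vx vy (inj₂ (q , walk)) (inj₂ (_ , walk′)) = chordal vx vy (append Adj walk q (reverse Adj Adj-sym walk′))

    module _ {a b} (πab : InPi G m a b) (¬ab : ¬ Adj a b) where
      private
        πba = InPi-sym πab
        ¬ba : ¬ Adj b a
        ¬ba = ¬ab ∘ Adj-sym
        a≢b = E⇒≢ (proj₁ πab)

      Adj⁺ : V → V → Set
      Adj⁺ x y = Adj x y ⊎ SamePair x y a b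

      Adj⁺-sym : ∀ {x y} → Adj⁺ x y → Adj⁺ y x
      Adj⁺-sym (inj₁ r) = inj₁ (Adj-sym r)
      Adj⁺-sym (inj₂ (inj₁ (p , q))) = inj₂ (inj₂ (q , p))
      Adj⁺-sym (inj₂ (inj₂ (p , q))) = inj₂ (inj₁ (q , p))

      Adj⁺⇒π⊎Adj : ∀ {x y} → Adj⁺ x y → Adj x y ⊎ InPi G m x y
      Adj⁺⇒π⊎Adj (inj₁ r) = inj₁ r
      Adj⁺⇒π⊎Adj (inj₂ (inj₁ (refl , refl))) = inj₂ πab
      Adj⁺⇒π⊎Adj (inj₂ (inj₂ (refl , refl))) = inj₂ πba

      neighbour-of-a : ∀ {x} → Adj⁺ a x → Adj a x ⊎ x ≡ b
      neighbour-of-a (inj₁ r) = inj₁ r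
      neighbour-of-a (inj₂ (inj₁ (_ , x≡b))) = inj₂ x≡b
      neighbour-of-a (inj₂ (inj₂ (a≡b , _))) = contradiction a≡b a≢b

      neighbour-of-b : ∀ {x} → Adj⁺ b x → Adj b x ⊎ x ≡ a
      neighbour-of-b (inj₁ r) = inj₁ r
      neighbour-of-b (inj₂ (inj₁ (b≡a , _))) = contradiction (sym b≡a) a≢b
      neighbour-of-b (inj₂ (inj₂ (_ , x≡a))) = inj₂ x≡a

      neighbour-of-other : ∀ {v x} → v ≢ a → v ≢ b → Adj⁺ v x → Adj v x
      neighbour-of-other v≢a v≢b (inj₁ r) = r
      neighbour-of-other v≢a v≢b (inj₂ (inj₁ (v≡a , _))) = contradiction v≡a v≢a
      neighbour-of-other v≢a v≢b (inj₂ (inj₂ (v≡b , _))) = contradiction v≡b v≢b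

      Adj⁺⇒≢ : ∀ {x y} → Adj⁺ x y → x ≢ y
      Adj⁺⇒≢ r = Sum.[ E⇒≢ ∘ Adj⇒E , E⇒≢ ∘ proj₁ ] (Adj⁺⇒π⊎Adj r)

      edge-avoiding : ∀ {v x y} → v ≡ a ⊎ v ≡ b → x ≢ v → y ≢ v → Adj⁺ x y → Adj x y
      edge-avoiding _ _ _ (inj₁ r) = r
      edge-avoiding (inj₁ refl) x≢v _ (inj₂ (inj₁ (x≡a , _))) = contradiction x≡a x≢v
      edge-avoiding (inj₁ refl) _ y≢v (inj₂ (inj₂ (_ , y≡a))) = contradiction y≡a y≢v
      edge-avoiding (inj₂ refl) _ y≢v (inj₂ (inj₁ (_ , y≡b))) = contradiction y≡b y≢v
      edge-avoiding (inj₂ refl) x≢v _ (inj₂ (inj₂ (x≡b , _))) = contradiction x≡b x≢v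

      -- The walk misses its centre, which is an end of ab, and so cannot use the new edge.
      walk-avoiding : ∀ {v x y} → v ≡ a ⊎ v ≡ b → x ≢ v → y ≢ v → Walk Adj⁺ (Out Adj⁺ v) x y → Walk Adj (Q v) x y
      walk-avoiding v∈ab x≢v y≢v (edge r) = edge (edge-avoiding v∈ab x≢v y≢v r)
      walk-avoiding v∈ab x≢v z≢v (cons r (y≢v , ¬vy) walk) =
        cons (edge-avoiding v∈ab x≢v y≢v r) (y≢v , ¬vy ∘ inj₁) (walk-avoiding v∈ab y≢v z≢v walk)

      -- After the last passage through ab only old edges follow; reversed, they lead from `y` to an
      -- end of ab.
      last-use : ∀ {P z y} → Walk Adj⁺ P z y → Walk Adj P z y ⊎ Reach P y a ⊎ Reach P y b
      last-use (edge (inj₁ r)) = inj₁ (edge r)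
      last-use (edge (inj₂ (inj₁ (_ , y≡b)))) = inj₂ (inj₂ (inj₁ y≡b))
      last-use (edge (inj₂ (inj₂ (_ , y≡a)))) = inj₂ (inj₁ (inj₁ y≡a))
      last-use (cons r p walk) with last-use walk
      ... | inj₂ reach = inj₂ reach
      ... | inj₁ walk′ with r
      ...   | inj₁ r′ = inj₁ (cons r′ p walk′)
      ...   | inj₂ (inj₁ (_ , refl)) = inj₂ (inj₂ (inj₂ (p , reverse Adj Adj-sym walk′)))
      ...   | inj₂ (inj₂ (_ , refl)) = inj₂ (inj₁ (inj₂ (p , reverse Adj Adj-sym walk′)))

      chordal⁺ : Chordal Adj⁺
      chordal⁺ {v} {x} {y} vx vy walk with v ≟ a | v ≟ b
      ... | yes refl | _ = Sum.map₂ inj₁ (centre-at-end πab ¬ab (neighbour-of-a vx) (neighbour-of-a vy)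
              (walk-avoiding (inj₁ refl) (Adj⁺⇒≢ (Adj⁺-sym vx)) (Adj⁺⇒≢ (Adj⁺-sym vy)) walk))
      ... | no _ | yes refl = Sum.map₂ inj₁ (centre-at-end πba ¬ba (neighbour-of-b vx) (neighbour-of-b vy)
              (walk-avoiding (inj₂ refl) (Adj⁺⇒≢ (Adj⁺-sym vx)) (Adj⁺⇒≢ (Adj⁺-sym vy)) walk))
      -- Cutting the walk in both directions gives old walks from `x` and from `y` to ends of ab. If
      -- these ends agree, the walks are joined there; if not, `detour` applies.
      ... | no v≢a | no v≢b = combine (last-use (reverse Adj⁺ Adj⁺-sym walk′)) (last-use walk′)
        where
        vx′ = neighbour-of-other v≢a v≢b vx
        vy′ = neighbour-of-other v≢a v≢b vy
        walk′ : Walk Adj⁺ (Q v) x y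
        walk′ = mapWalk Adj⁺ (λ { (z≢v , ¬vz) → z≢v , ¬vz ∘ inj₁ }) walk
        combine : Walk Adj (Q v) y x ⊎ Reach (Q v) x a ⊎ Reach (Q v) x b →
                  Walk Adj (Q v) x y ⊎ Reach (Q v) y a ⊎ Reach (Q v) y b → x ≡ y ⊎ Adj⁺ x y
        combine (inj₁ w) _ = Sum.map sym (inj₁ ∘ Adj-sym) (chordal vy′ vx′ w)
        combine _ (inj₁ w) = Sum.map₂ inj₁ (chordal vx′ vy′ w)
        combine (inj₂ (inj₁ xa)) (inj₂ (inj₁ ya)) = Sum.map₂ inj₁ (meet vx′ vy′ xa ya)
        combine (inj₂ (inj₂ xb)) (inj₂ (inj₂ yb)) = Sum.map₂ inj₁ (meet vx′ vy′ xb yb)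
        combine (inj₂ (inj₁ xa)) (inj₂ (inj₂ yb)) = Sum.[ Sum.map₂ inj₁ , inj₂ ∘ inj₂ ∘ inj₁ ] (detour πab ¬ab vx′ vy′ xa yb)
        combine (inj₂ (inj₂ xb)) (inj₂ (inj₁ ya)) = Sum.[ Sum.map₂ inj₁ , inj₂ ∘ inj₂ ∘ inj₂ ] (detour πba ¬ba vx′ vy′ xb ya)

      add-edge : Layer m
      add-edge = record
        { Adj = Adj⁺
        ; Adj? = λ x y → Adj? x y ⊎-dec samePair? x y a b
        ; Adj-sym = Adj⁺-sym
        ; Adj⇒E = Sum.[ Adj⇒E , proj₁ ] ∘ Adj⁺⇒π⊎Adj
        ; Adj⇒≤ = Sum.[ Adj⇒≤ , ≤-reflexive ∘ proj₂ ] ∘ Adj⁺⇒π⊎Adj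
        ; Low⇒Adj = inj₁ ∘ Low⇒Adj
        ; chordal = chordal⁺
        }

  module _ {m} (chordal< : Chordal (Low m)) where
    open Layer using (Adj)

    low-layer : Layer m
    low-layer = record
      { Adj = Low m
      ; Adj? = λ x y → E? x y ×-dec (lab x y <? m)
      ; Adj-sym = Low-sym
      ; Adj⇒E = proj₁
      ; Adj⇒≤ = <⇒≤ ∘ proj₂
      ; Low⇒Adj = id
      ; chordal = chordal<
      }

    -- Run over all ordered pairs, this ends at the graph of labels at most `m`.
    layer-containing : ∀ ps → Σ (Layer m) λ L → ∀ {x y} → (x , y) ∈ ps → InPi G m x y → Adj L x y
    layer-containing [] = low-layer , λ ()
    layer-containing ((a , b) ∷ ps) with layer-containing ps
    ... | L , complete with InPi? m a b | Layer.Adj? L a b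
    ...   | no ¬π | _ = L , λ { (here refl) π → contradiction π ¬π ; (there p∈) → complete p∈ }
    ...   | yes _ | yes ab = L , λ { (here refl) _ → ab ; (there p∈) → complete p∈ }
    ...   | yes π | no ¬ab = AddEdge.add-edge chordal< L π ¬ab ,
      λ { (here refl) _ → inj₂ (inj₁ (refl , refl)) ; (there p∈) → inj₁ ∘ complete p∈ }

    chordal-suc : Chordal (Low (suc m))
    chordal-suc = chordal-resp
      (λ r → Layer.Adj⇒E L r , s≤s (Layer.Adj⇒≤ L r))
      (λ { {x} {y} (e , s≤s l) → Sum.[ (λ lt → Layer.Low⇒Adj L (e , lt))
                       , (λ eq → complete (∈-cartesianProduct⁺ (∈-allFin x) (∈-allFin y)) (e , eq)) ] (m≤n⇒m<n∨m≡n l) })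
      (Layer.chordal L)
      where
      layer = layer-containing (cartesianProduct (allFin ℓ) (allFin ℓ))
      L = proj₁ layer
      complete = proj₂ layer

  chordal-Low : ∀ m → Chordal (Low m)
  chordal-Low zero (_ , ())
  chordal-Low (suc m) = chordal-suc (chordal-Low m)

  -- Principal cliques and the removal of generating vertices.

  Generates : V → V → Subset ℓ → Set
  Generates i j S = E i j × IsPrincipalCliqueOf G i j S

  Generates-swap : ∀ {i j S} → Generates i j S → Generates j i S
  Generates-swap (e , pc) = E-swap e , λ h → swap-clique ∘ proj₁ (pc h) , proj₂ (pc h) ∘ swap-clique
    where
    swap-clique : ∀ {i j h} → InClique i j h → InClique j i h
    swap-clique (inj₁ h≡i) = inj₂ (inj₁ h≡i)
    swap-clique (inj₂ (inj₁ h≡j)) = inj₁ h≡j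
    swap-clique (inj₂ (inj₂ c)) = inj₂ (inj₂ (Cond-swap c))

  Generates-unique : ∀ {i j S T} → Generates i j S → Generates i j T → S ≡ T
  Generates-unique (_ , pcS) (_ , pcT) =
    ⊆-antisym (λ {h} → proj₂ (pcT h) ∘ proj₁ (pcS h)) (λ {h} → proj₂ (pcS h) ∘ proj₁ (pcT h))

  clique-edge : ∀ {i j g h} → E i j → InClique i j g → InClique i j h → g ≢ h → SamePair g h i j ⊎ Low (lab i j) g h
  clique-edge e (inj₁ refl) (inj₁ refl) ne = contradiction refl ne
  clique-edge e (inj₁ refl) (inj₂ (inj₁ refl)) ne = inj₁ (inj₁ (refl , refl))
  clique-edge e (inj₁ refl) (inj₂ (inj₂ (ih , _ , l , _))) ne = inj₂ (ih , l)
  clique-edge e (inj₂ (inj₁ refl)) (inj₁ refl) ne = inj₁ (inj₂ (refl , refl))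
  clique-edge e (inj₂ (inj₁ refl)) (inj₂ (inj₁ refl)) ne = contradiction refl ne
  clique-edge e (inj₂ (inj₁ refl)) (inj₂ (inj₂ (_ , jh , _ , l))) ne = inj₂ (jh , l)
  clique-edge e (inj₂ (inj₂ (ig , _ , l , _))) (inj₁ refl) ne = inj₂ (Low-sym (ig , l))
  clique-edge e (inj₂ (inj₂ (_ , jg , _ , l))) (inj₂ (inj₁ refl)) ne = inj₂ (Low-sym (jg , l))
  clique-edge e (inj₂ (inj₂ cg)) (inj₂ (inj₂ ch)) ne = inj₂ (cond-clique (chordal-Low _) e cg ch ne)

  -- By the count in (ML2), the conditioning vertices of a maximal edge are exactly the rest of the clique.
  tight-clique : ∀ {S xs} → Unique xs → 1 ≤ length xs → (∀ {h} → h ∈ₛ S → h ∈ xs) → (∀ {h} → h ∈ xs → h ∈ₛ S) →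
    (∀ {u v} → u ∈ xs → v ∈ xs → u ≢ v → Low (length xs) u v) → InP G S
  tight-clique {xs = x ∷ []} _ _ S⇒xs xs⇒S _ = inj₁ (x , ⊆-antisym
    (λ h∈ → case-here (S⇒xs h∈)) (λ h∈ → subst (_∈ₛ _) (sym (x∈⁅y⁆⇒x≡y x h∈)) (xs⇒S (here refl))))
    where
    case-here : ∀ {h} → h ∈ x ∷ [] → h ∈ₛ ⁅ x ⁆
    case-here (here refl) = x∈⁅x⁆ x
  tight-clique {xs = _ ∷ _ ∷ _} uxs _ S⇒xs xs⇒S low =
    let u , v , u∈ , v∈ , uv , gen = clique-generator uxs (λ p q ne → proj₁ (low p q ne))
        clique⊆xs = unique-⊆∧length≥⇒⊇ _≟_ uxs (λ h∈ → ∈-clique⁺ uv (gen h∈))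
          (≤-trans (≤-reflexive (length-clique uv)) (proj₂ (low u∈ v∈ (E⇒≢ uv))))
    in inj₂ (u , v , uv , λ h → gen ∘ S⇒xs , xs⇒S ∘ clique⊆xs ∘ ∈-clique⁺ uv)

  module _ {i j S} (gen : Generates i j S) where
    private
      e = proj₁ gen
      k = lab i j

      S⇒clique : ∀ {h} → h ∈ₛ S → InClique i j h
      S⇒clique = proj₁ (proj₂ gen _)

      clique⇒S : ∀ {h} → InClique i j h → h ∈ₛ S
      clique⇒S = proj₂ (proj₂ gen _)

      cond⇒≢ˡ : ∀ {h} → Cond i j h → h ≢ i
      cond⇒≢ˡ (ih , _) = E⇒≢ (E-swap ih)

      cond⇒≢ʳ : ∀ {h} → Cond i j h → h ≢ j
      cond⇒≢ʳ (_ , jh , _) = E⇒≢ (E-swap jh)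

      unique-j : Unique (j ∷ conds e)
      unique-j with clique-unique e
      ... | _ ∷ u = u

      to-j : ∀ {h} → h ∈ₛ S - i → h ∈ j ∷ conds e
      to-j h∈ with S⇒clique (p-x⊆p S i h∈)
      ... | inj₁ refl = contradiction h∈ (x∉p-x S i)
      ... | inj₂ (inj₁ h≡j) = here h≡j
      ... | inj₂ (inj₂ c) = there (∈-conds⁺ e c)

      from-j : ∀ {h} → h ∈ j ∷ conds e → h ∈ₛ S - i
      from-j (here refl) = x∈p∧x≢y⇒x∈p-y (clique⇒S (inj₂ (inj₁ refl))) (E⇒≢ (E-swap e))
      from-j (there h∈) = x∈p∧x≢y⇒x∈p-y (clique⇒S (inj₂ (inj₂ (∈-conds⁻ e h∈)))) (cond⇒≢ˡ (∈-conds⁻ e h∈))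

      to-conds : ∀ {h} → h ∈ₛ S - i - j → h ∈ conds e
      to-conds h∈ with to-j (p-x⊆p (S - i) j h∈)
      ... | here refl = contradiction h∈ (x∉p-x (S - i) j)
      ... | there h∈′ = h∈′

      from-conds : ∀ {h} → h ∈ conds e → h ∈ₛ S - i - j
      from-conds h∈ = x∈p∧x≢y⇒x∈p-y (from-j (there h∈)) (cond⇒≢ʳ (∈-conds⁻ e h∈))

    j∈S-i : j ∈ₛ S - i
    j∈S-i = from-j (here refl)

    size : ∣ S ∣ ≡ suc (lab i j)
    size = trans (size≡length (clique-unique e) (∈-clique⁺ e ∘ S⇒clique) (clique⇒S ∘ ∈-clique⁻ e)) (length-clique e)

    size-removed : ∣ S - i ∣ ≡ lab i j
    size-removed = trans (size≡length unique-j to-j from-j) (1+length-conds e)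

    size-removed₂ : suc ∣ S - i - j ∣ ≡ lab i j
    size-removed₂ = trans (cong suc (size≡length (conds-unique e) to-conds from-conds)) (1+length-conds e)

    -- Only the edge ij has label k in `S`. Without `i`, there remain k vertices with all labels
    -- below k, which is the case of `tight-clique`.
    remove-end : InP G (S - i)
    remove-end = tight-clique unique-j (s≤s z≤n) to-j from-j λ u∈ v∈ u≢v → low u∈ v∈ u≢v
      (clique-edge e (S⇒clique (p-x⊆p S i (from-j u∈))) (S⇒clique (p-x⊆p S i (from-j v∈))) u≢v)
      where
      low : ∀ {u v} → u ∈ j ∷ conds e → v ∈ j ∷ conds e → u ≢ v → SamePair u v i j ⊎ Low k u v → Low (length (j ∷ conds e)) u v
      low u∈ _ _ (inj₁ (inj₁ (u≡i , _))) = contradiction u≡i (∈-⇒≢ {p = S} (from-j u∈))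
      low _ v∈ _ (inj₁ (inj₂ (_ , v≡i))) = contradiction v≡i (∈-⇒≢ {p = S} (from-j v∈))
      low _ _ _ (inj₂ (uv , l)) = uv , <-≤-trans l (≤-reflexive (sym (1+length-conds e)))

    -- If uv had label k - 1, then the whole clique, which has k + 1 elements, would lie in the principal clique of uv.
    remove-both : 2 ≤ lab i j → InP G (S - i - j)
    remove-both 2≤k = tight-clique (conds-unique e) (s≤s⁻¹ (≤-trans 2≤k (≤-reflexive (sym (1+length-conds e))))) to-conds from-conds
      λ u∈ v∈ u≢v → low (∈-conds⁻ e u∈) (∈-conds⁻ e v∈) (cond-clique (chordal-Low k) e (∈-conds⁻ e u∈) (∈-conds⁻ e v∈) u≢v)
      where
      below-k : ∀ {u h} → Cond i j u → InClique i j h → u ≢ h → Low k u h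
      below-k c h∈ u≢h with clique-edge e (inj₂ (inj₂ c)) h∈ u≢h
      ... | inj₂ l = l
      ... | inj₁ (inj₁ (u≡i , _)) = contradiction u≡i (cond⇒≢ˡ c)
      ... | inj₁ (inj₂ (u≡j , _)) = contradiction u≡j (cond⇒≢ʳ c)
      low : ∀ {u v} → Cond i j u → Cond i j v → Low k u v → Low (length (conds e)) u v
      low {u} {v} cu cv (uv , l) with m≤n⇒m<n∨m≡n (s≤s⁻¹ (≤-trans l (≤-reflexive (sym (1+length-conds e)))))
      ... | inj₁ l′ = uv , l′
      ... | inj₂ eq = contradiction (≤-trans (≤-reflexive (sym (length-clique e)))
                                             (length≤clique uv (clique-unique e) (λ h∈ → generated (∈-clique⁻ e h∈))))
                                    (λ le → <-irrefl refl (≤-trans (s≤s l) le))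
        where
        k≡1+ : k ≡ suc (lab u v)
        k≡1+ = trans (sym (1+length-conds e)) (cong suc (sym eq))
        ≤uv : ∀ {s t} → Low k s t → lab s t ≤ lab u v
        ≤uv (_ , l) = s≤s⁻¹ (≤-trans l (≤-reflexive k≡1+))
        generated : ∀ {h} → InClique i j h → InClique u v h
        generated {h} h∈ with h ≟ u | h ≟ v
        ... | yes h≡u | _ = inj₁ h≡u
        ... | no _ | yes h≡v = inj₂ (inj₁ h≡v)
        ... | no h≢u | no h≢v = inj₂ (inj₂ (proj₁ uh , proj₁ vh
          , ≤∧≢⇒< (≤uv uh) (λ eq → no-triangle (InPi-sym (proj₁ uh , eq)) (uv , refl) (proj₁ (Low-sym vh)) (≤uv (Low-sym vh)))
          , ≤∧≢⇒< (≤uv vh) (λ eq → no-triangle (uv , refl) (proj₁ vh , eq) (proj₁ uh) (≤uv uh))))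
          where
          uh = below-k cu h∈ (h≢u ∘ sym)
          vh = below-k cv h∈ (h≢v ∘ sym)

    -- If ij is not the generating edge of `T`, its label is smaller than that of the generating
    -- edge, and then `T` is larger than `S`.
    contains-ends⇒≡ : ∀ {T} → InP G T → T ⊆ S → i ∈ₛ T → j ∈ₛ T → T ≡ S
    contains-ends⇒≡ (inj₁ (h , refl)) _ i∈ j∈ = contradiction (trans (x∈⁅y⁆⇒x≡y h i∈) (sym (x∈⁅y⁆⇒x≡y h j∈))) (E⇒≢ e)
    contains-ends⇒≡ (inj₂ (c , d , cd , pc)) T⊆S i∈ j∈ with clique-edge cd (proj₁ (pc i) i∈) (proj₁ (pc j) j∈) (E⇒≢ e)
    ... | inj₁ (inj₁ (refl , refl)) = Generates-unique (cd , pc) gen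
    ... | inj₁ (inj₂ (refl , refl)) = Generates-unique (Generates-swap (cd , pc)) gen
    ... | inj₂ (_ , k<l) = contradiction
            (subst₂ _≤_ size-T size (p⊆q⇒∣p∣≤∣q∣ T⊆S)) (λ le → <-irrefl refl (≤-trans (s≤s k<l) le))
      where
      size-T = trans (size≡length (clique-unique cd) (∈-clique⁺ cd ∘ proj₁ (pc _)) (proj₂ (pc _) ∘ ∈-clique⁻ cd)) (length-clique cd)

    below-generator : ∀ {T} → InP G T → T ⊆ S → T ≡ S ⊎ T ⊆ S - i ⊎ T ⊆ S - j
    below-generator {T} T∈ T⊆S with i ∈? T | j ∈? T
    ... | yes i∈ | yes j∈ = inj₁ (contains-ends⇒≡ T∈ T⊆S i∈ j∈)
    ... | no i∉ | _ = inj₂ (inj₁ λ h∈ → x∈p∧x≢y⇒x∈p-y (T⊆S h∈) λ { refl → i∉ h∈ })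
    ... | yes _ | no j∉ = inj₂ (inj₂ λ h∈ → x∈p∧x≢y⇒x∈p-y (T⊆S h∈) λ { refl → j∉ h∈ })

  size≥1 : ∀ {S} → InP G S → 1 ≤ ∣ S ∣
  size≥1 (inj₁ (i , refl)) = ≤-reflexive (sym (∣⁅x⁆∣≡1 i))
  size≥1 (inj₂ (i , j , gen)) = ≤-trans (s≤s z≤n) (≤-reflexive (sym (size gen)))

  -- The vine axioms, for the whole poset and its principal ideals at once.

  module DownSet (In : Subset ℓ → Set) (In⇒InP : ∀ {x} → In x → InP G x)
                 (down : ∀ {x y} → In x → InP G y → y ⊆ x → In y) where
    open Vines In _⊆_ ∣_∣

    ≺⇒size< : ∀ {x y} → x ≺ y → ∣ x ∣ < ∣ y ∣
    ≺⇒size< (x⊆y , x≢y) = ≰⇒> λ y≤x → x≢y (⊆∧size≥⇒≡ x⊆y y≤x)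

    cover : ∀ {x y} → In x → In y → x ⊆ y → ∣ y ∣ ≡ suc ∣ x ∣ → x ⋖ y
    cover x∈ y∈ x⊆y eq = x∈ , y∈ , (x⊆y , λ { refl → <-irrefl eq (n<1+n _) })
      , λ z _ (x≺z , z≺y) → <-irrefl refl (<-≤-trans (≤-<-trans (≺⇒size< x≺z) (≺⇒size< z≺y)) (≤-reflexive eq))

    nothing-below-singleton : ∀ {i y} → In y → ¬ (y ≺ ⁅ i ⁆)
    nothing-below-singleton {i} y∈ y≺ = <-irrefl refl
      (<-≤-trans (≤-<-trans (size≥1 (In⇒InP y∈)) (≺⇒size< y≺)) (≤-reflexive (∣⁅x⁆∣≡1 i)))

    module _ {i j v} (gen : Generates i j v) (v∈ : In v) where

      In-removed : In (v - i)
      In-removed = down v∈ (remove-end gen) (p-x⊆p v i)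

      removed-cover : (v - i) ⋖ v
      removed-cover = cover In-removed v∈ (p-x⊆p v i) (trans (size gen) (cong suc (sym (size-removed gen))))

    -- `v - i` lies between `x` and `v`, where a covering leaves no room.
    covered-in-removed : ∀ {i j v x} → Generates i j v → x ⋖ v → x ⊆ v - i → x ≡ v - i
    covered-in-removed {i} {v = v} {x} gen (_ , v∈ , _ , nothing-between) x⊆ with ≡-dec _≟ᵇ_ x (v - i)
    ... | yes x≡ = x≡
    ... | no x≢ = let w∈ , _ , w≺v , _ = removed-cover gen v∈ in ⊥-elim (nothing-between (v - i) w∈ ((x⊆ , x≢) , w≺v))

    covered-by-generated : ∀ {i j v x} → Generates i j v → x ⋖ v → x ≡ v - i ⊎ x ≡ v - j
    covered-by-generated gen x⋖v@(x∈ , _ , (x⊆v , x≢v) , _) with below-generator gen (In⇒InP x∈) x⊆v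
    ... | inj₁ x≡v = contradiction x≡v x≢v
    ... | inj₂ (inj₁ x⊆) = inj₁ (covered-in-removed gen x⋖v x⊆)
    ... | inj₂ (inj₂ x⊆) = inj₂ (covered-in-removed (Generates-swap gen) x⋖v x⊆)

    removed-≢ : ∀ {i j v} → Generates i j v → v - i ≢ v - j
    removed-≢ {i} {j} {v} gen eq = x∉p-x v j (subst (j ∈ₛ_) eq (j∈S-i gen))

    cover-generators : ∀ {x v} → x ⋖ v → ∃₂ λ i j → Generates i j v
    cover-generators (x∈ , v∈ , x≺v , _) with In⇒InP v∈
    ... | inj₁ (_ , refl) = ⊥-elim (nothing-below-singleton x∈ x≺v)
    ... | inj₂ gen = gen

    covered-pair : ∀ {x y v} → x ≢ y → x ⋖ v → y ⋖ v → ∃₂ λ i j → Generates i j v × x ≡ v - j × y ≡ v - i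
    covered-pair x≢y x⋖v y⋖v with cover-generators x⋖v
    ... | i , j , gen with covered-by-generated gen x⋖v | covered-by-generated gen y⋖v
    ...   | inj₁ x≡ | inj₁ y≡ = contradiction (trans x≡ (sym y≡)) x≢y
    ...   | inj₁ x≡ | inj₂ y≡ = j , i , Generates-swap gen , x≡ , y≡
    ...   | inj₂ x≡ | inj₁ y≡ = i , j , gen , x≡ , y≡
    ...   | inj₂ x≡ | inj₂ y≡ = contradiction (trans x≡ (sym y≡)) x≢y

    isPoset : IsPoset
    isPoset = (λ _ _ → ⊆-refl) , (λ _ _ _ _ → ⊆-antisym) , (λ _ _ _ _ _ _ → ⊆-trans)

    minimal⇒singleton : ∀ {x} → Minimal x → ∃[ i ] x ≡ ⁅ i ⁆
    minimal⇒singleton (x∈ , min) with In⇒InP x∈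
    ... | inj₁ s = s
    ... | inj₂ (i , j , gen) = let y∈ , _ , y≺x , _ = removed-cover gen x∈ in ⊥-elim (min _ y∈ y≺x)

    singleton-minimal : ∀ {i} → In ⁅ i ⁆ → Minimal ⁅ i ⁆
    singleton-minimal i∈ = i∈ , λ _ → nothing-below-singleton

    isGraded : IsGraded
    isGraded = (λ _ _ _ _ → ≺⇒size<) , cover-rank
      , λ x min → let i , eq = minimal⇒singleton min in trans (cong ∣_∣ eq) (∣⁅x⁆∣≡1 i)
      where
      cover-rank : ∀ x y → x ⋖ y → ∣ y ∣ ≡ suc ∣ x ∣
      cover-rank x y x⋖y with cover-generators x⋖y
      ... | i , j , gen with covered-by-generated gen x⋖y
      ...   | inj₁ refl = trans (size gen) (cong suc (sym (size-removed gen)))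
      ...   | inj₂ refl = let gen′ = Generates-swap gen in trans (size gen′) (cong suc (sym (size-removed gen′)))

    covers-two : ∀ v → In v → ¬ Minimal v →
      ∃₂ λ x y → x ≢ y × x ⋖ v × y ⋖ v × (∀ z → z ⋖ v → z ≡ x ⊎ z ≡ y)
    covers-two v v∈ ¬min with In⇒InP v∈
    ... | inj₁ (i , refl) = contradiction (singleton-minimal v∈) ¬min
    ... | inj₂ (i , j , gen) = v - i , v - j , removed-≢ gen , removed-cover gen v∈ , removed-cover (Generates-swap gen) v∈
      , λ _ → covered-by-generated gen

    -- `v` is the union of `x` and `y`, since these arise from it by removing different vertices.
    -- Used both ways, this makes the common cover unique.
    common-cover-⊆ : ∀ {x y v w} → x ≢ y → x ⋖ v → y ⋖ v → x ⊆ w → y ⊆ w → v ⊆ w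
    common-cover-⊆ x≢y x⋖v y⋖v x⊆w y⊆w {h} h∈ with covered-pair x≢y x⋖v y⋖v
    ... | i , j , gen , refl , refl with h ≟ j
    ...   | yes refl = y⊆w (j∈S-i gen)
    ...   | no h≢j = x⊆w (x∈p∧x≢y⇒x∈p-y h∈ h≢j)

    common-cover-unique : ∀ x y v w → ∣ x ∣ ≡ ∣ y ∣ → x ≢ y → x ⋖ v → y ⋖ v → x ⋖ w → y ⋖ w → v ≡ w
    common-cover-unique _ _ _ _ _ x≢y xv yv xw yw =
      ⊆-antisym (common-cover-⊆ x≢y xv yv (below xw) (below yw)) (common-cover-⊆ x≢y xw yw (below xv) (below yv))
      where
      below : ∀ {x v} → x ⋖ v → x ⊆ v
      below (_ , _ , (x⊆v , _) , _) = x⊆v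

    -- The graphs F_k are forests.

    exchange : ∀ {k x y} → FEdge k x y → ∃₂ λ a b → ∃[ v ] Generates a b v × lab a b ≡ k × x ≡ v - b × y ≡ v - a
    exchange (_ , _ , x≢y , v , rk-v , x⋖v , y⋖v) =
      let a , b , gen , x≡ , y≡ = covered-pair x≢y x⋖v y⋖v
      in a , b , v , gen , suc-injective (trans (sym (size gen)) rk-v) , x≡ , y≡

    module _ {k a b v} (gen : Generates a b v) (ab≡k : lab a b ≡ k) where
      private
        R : V → V → Set
        R c d = InPi G k c d × ¬ SamePair c d a b

        R? : ∀ c d → Dec (R c d)
        R? c d = InPi? k c d ×-dec ¬? (samePair? c d a b)

        New : Subset ℓ → Set
        New p = p ≢ v - b × p ≢ v - a

        Token : Subset ℓ → Set
        Token p = ∃[ t ] t ∈ₛ p × Star R b t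

        -- The edge ab determines its principal clique `v`, and with it both ends of the edge of
        -- F_k.
        same-edge⇒¬new : ∀ {c d w} → Generates c d w → SamePair c d a b → ¬ (New (w - d) ⊎ New (w - c))
        same-edge⇒¬new gen′ (inj₁ (refl , refl)) new with Generates-unique gen gen′
        ... | refl = Sum.[ (λ n → proj₁ n refl) , (λ n → proj₂ n refl) ] new
        same-edge⇒¬new gen′ (inj₂ (refl , refl)) new with Generates-unique gen (Generates-swap gen′)
        ... | refl = Sum.[ (λ n → proj₂ n refl) , (λ n → proj₁ n refl) ] new

        -- The step replaces `c` by `d`: a token on `c` follows the edge cd, any other token stays.
        -- One new end suffices to know that cd is not ab, which also covers the steps leaving
        -- `v - a` and entering `v - b`.
        move : ∀ {p q} → FEdge k p q → New p ⊎ New q → Token p → Token q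
        move pq new (t , t∈ , path) with exchange pq
        ... | c , d , w , gen′ , cd≡k , refl , refl with t ≟ c
        ...   | no t≢c = t , x∈p∧x≢y⇒x∈p-y (p-x⊆p w d t∈) t≢c , path
        ...   | yes refl = d , j∈S-i gen′ , path ◅◅ (((proj₁ gen′ , cd≡k) , λ same → same-edge⇒¬new gen′ same new) ◅ ε)

        transport : ∀ {p} ps → Linked (FEdge k) (p ∷ ps ++ (v - b) ∷ []) → All New (p ∷ ps) → Token p → Token (v - b)
        transport [] (px ∷ _) (new ∷ _) = move px (inj₁ new)
        transport (_ ∷ ps) (pq ∷ walk) (new ∷ news) = transport ps walk news ∘ move pq (inj₁ new)

        no-token : ¬ Token (v - b)
        no-token (t , t∈ , path) with proj₁ (proj₂ gen t) (p-x⊆p v b t∈)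
        ... | inj₁ refl = no-detour (E-swap (proj₁ gen)) (≤-reflexive (trans (lab-sym b a) ab≡k)) R R? proj₁
                (λ r → proj₂ r (inj₂ (refl , refl))) path
        ... | inj₂ (inj₁ t≡b) = ∈-⇒≢ {p = v} t∈ t≡b
        ... | inj₂ (inj₂ (at , _ , l , _)) = no-detour at (<⇒≤ l′) (InPi G k) (InPi? k) (id) (λ π → <-irrefl (proj₂ π) l′)
                ((proj₁ gen , ab≡k) ◅ Star.map proj₁ path)
          where
          l′ = <-≤-trans l (≤-reflexive ab≡k)

      -- Each edge of F_k replaces an end a of an edge of π_k by its other end b, and different edges of F_k come from different
      -- edges of π_k.  Once around a cycle of F_k, a token put on b after the first step travels along π_k without using ab, yet
      -- it ends on a vertex t of the first clique.  By (ML1), t is not a, and it is no other vertex either, as at has label < k.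
      no-cycle-through : ∀ {z} rest → FEdge k (v - a) z → Linked (FEdge k) (z ∷ rest ++ (v - b) ∷ []) → ¬ All New (z ∷ rest)
      no-cycle-through rest yz walk news =
        no-token (transport rest walk news (move yz (inj₂ (All.head news)) (b , j∈S-i gen , ε)))

    forest : ∀ k → IsForest k
    forest k (_ , [] , () , _)
    forest k (_ , _ ∷ [] , s≤s () , _)
    forest k (_ , _ ∷ _ ∷ rest , _ , ((_ ∷ x∉) ∷ y∉ ∷ _) , (xy ∷ yz ∷ walk)) with exchange xy
    ... | _ , _ , _ , gen , ab≡k , refl , refl =
      no-cycle-through gen ab≡k rest yz walk (All.map (λ (x≢ , y≢) → x≢ ∘ sym , y≢ ∘ sym) (All.zip (x∉ , y∉)))

    isVine : IsVine
    isVine = isPoset , isGraded , covers-two , common-cover-unique , λ k _ → forest k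

    -- `v - i` and `v - j` both cover `v - i - j`. Their rank is the label of ij, so rank at least 2
    -- is what `remove-both` asks for.
    proximity : Proximity
    proximity x y v 2≤x _ x≢y x⋖v@(x∈ , v∈ , _) y⋖v@(y∈ , _) with covered-pair x≢y x⋖v y⋖v
    ... | i , j , gen , refl , refl = z , below-x , below-y
      where
      gen′ = Generates-swap gen
      z = v - i - j
      z∈ : In z
      z∈ = down y∈ (remove-both gen (≤-trans 2≤x (≤-reflexive (trans (size-removed gen′) (lab-sym j i))))) (p-x⊆p (v - i) j)
      below-y : z ⋖ (v - i)
      below-y = cover z∈ y∈ (p-x⊆p (v - i) j) (trans (size-removed gen) (sym (size-removed₂ gen)))
      below-x : z ⋖ (v - j)
      below-x with p─x─y≡p─y─x v i j
      ... | eq = cover z∈ x∈ (λ h∈ → p-x⊆p (v - j) i (subst (_ ∈ₛ_) eq h∈))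
              (trans (size-removed gen′) (trans (lab-sym j i) (sym (size-removed₂ gen))))

    -- Connectedness of the graphs F_k.

    element-below : ∀ {k} n w → ∣ w ∣ ≤ n → In w → 1 ≤ k → k ≤ ∣ w ∣ → ∃[ z ] In z × ∣ z ∣ ≡ k × z ⊆ w
    element-below {k} n w w≤n w∈ 1≤k k≤w with k ≟ℕ ∣ w ∣
    ... | yes refl = w , w∈ , refl , ⊆-refl
    ... | no k≢w with In⇒InP w∈
    ...   | inj₁ (i , refl) = contradiction (≤-antisym k≤w (≤-trans (≤-reflexive (∣⁅x⁆∣≡1 i)) 1≤k)) k≢w
    element-below zero w w≤n w∈ 1≤k k≤w | no k≢w | inj₂ _ = contradiction (≤-trans 1≤k (≤-trans k≤w w≤n)) λ ()
    element-below (suc n) w w≤n w∈ 1≤k k≤w | no k≢w | inj₂ (i , j , gen) =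
      let eq = trans (size gen) (cong suc (sym (size-removed gen)))
          z , z∈ , rk-z , z⊆ = element-below n (w - i) (s≤s⁻¹ (≤-trans (≤-reflexive (sym eq)) w≤n)) (In-removed gen w∈) 1≤k
            (s≤s⁻¹ (≤-trans (≤∧≢⇒< k≤w k≢w) (≤-reflexive eq)))
      in z , z∈ , rk-z , ⊆-trans z⊆ (p-x⊆p w i)

    Connected : ℕ → Subset ℓ → Set
    Connected k w = ∀ {x y} → Vert k x → Vert k y → x ⊆ w → y ⊆ w → Star (FEdge k) x y

    -- If k is the label of ij, then `x` and `y` are `w - i` and `w - j`, joined in F_k by `w`.
    -- Otherwise some element of rank k lies below `w - i - j`, hence below both sides, and the two
    -- connections meet there.
    bridge : ∀ {k i j w} → 1 ≤ k → Generates i j w → In w → Connected k (w - i) → Connected k (w - j) →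
      ∀ {x y} → Vert k x → Vert k y → x ⊆ w - i → y ⊆ w - j → Star (FEdge k) x y
    bridge {k} {i} {j} {w} 1≤k gen w∈ conᵢ conⱼ {x} {y} vx@(x∈ , rk-x) vy@(y∈ , rk-y) x⊆ y⊆ with k ≟ℕ lab i j
    ... | yes refl
      with refl ← ⊆∧size≥⇒≡ x⊆ (≤-reflexive (trans (size-removed gen) (sym rk-x)))
         | refl ← ⊆∧size≥⇒≡ y⊆ (≤-reflexive (trans (size-removed (Generates-swap gen)) (trans (lab-sym j i) (sym rk-y)))) =
      (rk-x , rk-y , removed-≢ gen , w , size gen , removed-cover gen w∈ , removed-cover (Generates-swap gen) w∈) ◅ ε
    ... | no k≢ = conᵢ vx (z∈ , rk-z) x⊆ (⊆-trans z⊆ (p-x⊆p (w - i) j)) ◅◅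
                  conⱼ (z∈ , rk-z) vy (λ h∈ → x∈p∧x≢y⇒x∈p-y (p-x⊆p w i (p-x⊆p (w - i) j (z⊆ h∈))) (∈-⇒≢ {p = w - i} (z⊆ h∈))) y⊆
      where
      k<lab : k < lab i j
      k<lab = ≤∧≢⇒< (≤-trans (≤-reflexive (sym rk-x)) (≤-trans (p⊆q⇒∣p∣≤∣q∣ x⊆) (≤-reflexive (size-removed gen)))) k≢
      u∈ : In (w - i - j)
      u∈ = down (In-removed gen w∈) (remove-both gen (≤-trans (s≤s 1≤k) k<lab)) (p-x⊆p (w - i) j)
      below = element-below _ (w - i - j) ≤-refl u∈ 1≤k (s≤s⁻¹ (≤-trans k<lab (≤-reflexive (sym (size-removed₂ gen)))))
      z∈ = proj₁ (proj₂ below)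
      rk-z = proj₁ (proj₂ (proj₂ below))
      z⊆ = proj₂ (proj₂ (proj₂ below))

    ≡-connected : ∀ {k x y w} → Vert k x → Vert k y → x ≡ w → y ⊆ w → Star (FEdge k) x y
    ≡-connected (_ , rk-x) (_ , rk-y) refl y⊆ with refl ← ⊆∧size≥⇒≡ y⊆ (≤-reflexive (trans rk-x (sym rk-y))) = ε

    connected-from-removed : ∀ {k i j w} → 1 ≤ k → Generates i j w → In w → Connected k (w - i) → Connected k (w - j) → Connected k w
    connected-from-removed 1≤k gen w∈ conᵢ conⱼ vx@(x∈ , rk-x) vy@(y∈ , rk-y) x⊆ y⊆
      with below-generator gen (In⇒InP x∈) x⊆ | below-generator gen (In⇒InP y∈) y⊆
    ... | inj₁ x≡w | _ = ≡-connected vx vy x≡w y⊆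
    ... | inj₂ _ | inj₁ refl with refl ← ⊆∧size≥⇒≡ x⊆ (≤-reflexive (trans rk-y (sym rk-x))) = ε
    ... | inj₂ (inj₁ x⊆ᵢ) | inj₂ (inj₁ y⊆ᵢ) = conᵢ vx vy x⊆ᵢ y⊆ᵢ
    ... | inj₂ (inj₂ x⊆ⱼ) | inj₂ (inj₂ y⊆ⱼ) = conⱼ vx vy x⊆ⱼ y⊆ⱼ
    ... | inj₂ (inj₁ x⊆ᵢ) | inj₂ (inj₂ y⊆ⱼ) = bridge 1≤k gen w∈ conᵢ conⱼ vx vy x⊆ᵢ y⊆ⱼ
    ... | inj₂ (inj₂ x⊆ⱼ) | inj₂ (inj₁ y⊆ᵢ) = bridge 1≤k (Generates-swap gen) w∈ conⱼ conᵢ vx vy x⊆ⱼ y⊆ᵢ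

    connected : ∀ {k} n w → ∣ w ∣ ≤ n → In w → 1 ≤ k → Connected k w
    connected n w w≤n w∈ 1≤k with In⇒InP w∈
    connected n w w≤n w∈ 1≤k | inj₁ (i , refl) = λ vx vy x⊆ y⊆ → ≡-connected vx vy
      (⊆∧size≥⇒≡ x⊆ (≤-trans (≤-reflexive (∣⁅x⁆∣≡1 i)) (size≥1 (In⇒InP (proj₁ vx))))) y⊆
    connected zero w w≤n w∈ 1≤k | inj₂ _ = contradiction (≤-trans (size≥1 (In⇒InP w∈)) w≤n) λ ()
    connected {k} (suc n) w w≤n w∈ 1≤k | inj₂ (i , j , gen) =
      connected-from-removed 1≤k gen w∈ (below gen) (below (Generates-swap gen))
      where
      below : ∀ {i j} → Generates i j w → Connected k (w - i)
      below {i} gen = connected n (w - i)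
        (s≤s⁻¹ (≤-trans (s≤s (≤-reflexive (size-removed gen))) (≤-trans (≤-reflexive (sym (size gen))) w≤n)))
        (In-removed gen w∈) 1≤k

    -- A largest element `v` fixes both numbers: the rank is its size, and the minimal elements are
    -- the singletons of its vertices. Connectedness below `v` is connectedness everywhere.
    isRVine : ∀ {v} → In v → (∀ {x} → In x → x ⊆ v) → Vines.IsRVine In _⊆_ ∣_∣
    isRVine {v} v∈ top = isVine
      , (∣ v ∣ , ((λ _ x∈ → p⊆q⇒∣p∣≤∣q∣ (top x∈)) , inj₂ (v , v∈ , refl)) , dim (card-subset v))
      , (λ k (1≤k , _) → forest k , λ _ _ vx vy → connected _ v ≤-refl v∈ 1≤k vx vy (top (proj₁ vx)) (top (proj₁ vy)))
      , proximity
      where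
      dim : Card (_∈ₛ v) ∣ v ∣ → DimIs ∣ v ∣
      dim (xs , uxs , pxs , cxs , eq) =
          map ⁅_⁆ xs
        , map⁺ ⁅⁆-injective uxs
        , Allₚ.map⁺ (All.map (λ {i} i∈ → singleton-minimal (down v∈ (inj₁ (i , refl))
            λ h∈ → subst (_∈ₛ v) (sym (x∈⁅y⁆⇒x≡y i h∈)) i∈)) pxs)
        , complete
        , trans (length-map ⁅_⁆ xs) eq
        where
        complete : ∀ x → Minimal x → x ∈ map ⁅_⁆ xs
        complete x min with minimal⇒singleton min
        ... | i , refl = ∈-map⁺ ⁅_⁆ (cxs i (top (proj₁ min) (x∈⁅x⁆ i)))

  -- The whole poset, its principal ideals and complete graphs.

  module Whole = DownSet (InP G) id (λ _ y∈ _ → y∈)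

  ideal-isRVine : ∀ v → InP G v → IsRVine (λ y → InP G y × y ⊆ v) _⊆_ ∣_∣
  ideal-isRVine v v∈ = DownSet.isRVine (λ y → InP G y × y ⊆ v) proj₁
    (λ x∈ y∈ y⊆x → y∈ , ⊆-trans y⊆x (proj₂ x∈)) (v∈ , ⊆-refl) proj₂

  -- All vertices together form a clique, so the principal clique of a generating edge contains them
  -- all; a single vertex gives a singleton instead. This supplies the largest element for
  -- `isRVine`.
  complete⇒full-clique : IsComplete G → V → InP G full
  complete⇒full-clique complete v = from-list (allFin ℓ) (allFin⁺ ℓ) ∈-allFin
    where
    from-list : ∀ xs → Unique xs → (∀ h → h ∈ xs) → InP G full
    from-list [] _ all with () ← all v
    from-list (x ∷ []) _ all = inj₁ (x , ⊆-antisym (λ {h} _ → only (all h)) ⊆⊤)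
      where
      only : ∀ {h} → h ∈ x ∷ [] → h ∈ₛ ⁅ x ⁆
      only (here refl) = x∈⁅x⁆ x
    from-list (_ ∷ _ ∷ _) uxs all =
      let i , j , _ , _ , ij , gen = clique-generator uxs (λ _ _ → complete _ _)
      in inj₂ (i , j , ij , λ h → (λ _ → gen (all h)) , λ _ → ∈⊤)

  -- The empty poset has no largest element; its rank is 0 by convention, which agrees with its
  -- dimension.
  no-vertices⇒isRVine : ¬ V → IsRVine (InP G) _⊆_ ∣_∣
  no-vertices⇒isRVine ¬v = Whole.isVine
    , (0 , ((λ x x∈ → ⊥-elim (¬In x x∈)) , inj₁ (refl , ¬In))
         , ([] , [] , [] , (λ x min → ⊥-elim (¬In x (proj₁ min))) , refl))
    , (λ k inRange → Whole.forest k , λ x _ vx → ⊥-elim (¬In x (proj₁ vx)))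
    , Whole.proximity
    where
    ¬In : ∀ x → ¬ InP G x
    ¬In x (inj₁ (i , _)) = ¬v i
    ¬In x (inj₂ (i , _)) = ¬v i

theorem4p13 : (ℓ : ℕ) (G : LabeledGraph ℓ) → IsMAT G →
    IsLRVine (InP G) _⊆_ ∣_∣ × (IsComplete G → IsRVine (InP G) _⊆_ ∣_∣)
theorem4p13 ℓ G mat = (Whole.isVine , ideal-isRVine) , complete-isRVine ℓ refl
  where
  open MAT G mat
  -- The separate `n` permits the case distinction on `ℓ`, on which `G` depends.
  complete-isRVine : ∀ n → n ≡ ℓ → IsComplete G → IsRVine (InP G) _⊆_ ∣_∣
  complete-isRVine zero refl _ = no-vertices⇒isRVine λ ()
  complete-isRVine (suc _) refl complete = Whole.isRVine (complete⇒full-clique complete zero) (λ _ → ⊆⊤)
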